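{- There is an absolute constant $C$ such that the following holds. Let $G$ be a connected bipartite graph with bipartition $X, Y$, let $\overline d$ be the average degree of vertices in $X$ and $\overline c$ the average degree of vertices in $Y$, and let $\epsilon>0$. Suppose that for all $U \subseteq X$ and $V \subseteq Y$, \[ \left| e(U,V) - \frac{|U||V|\,\overline c}{|X|} \right| \leq \epsilon \sqrt{|U||V|}. \] Then the spectral gap of the normalized Laplacian of $G$ is at least \[ 1 - \frac{C\epsilon \log\!\big((\Delta(G) + \overline d + \overline c)/\epsilon\big) + C}{\delta(G)} - \frac{2\sigma_X\sigma_Y}{\delta(X)\delta(Y)}. \]
   Context: $e(U,V)$ is the number of edges between $U$ and $V$. $\Delta(G)$ and $\delta(G)$ denote the maximum and minimum vertex degree of $G$; $\delta(X)$, $\delta(Y)$ denote the minimum degree among vertices of $X$, respectively $Y$; $\sigma_X$, $\sigma_Y$ are the standard deviations of the degree sequences of $X$ and $Y$. For a graph without isolated vertices with adjacency matrix $A$ and diagonal degree matrix $D$, the normalized Laplacian is $\mathcal L = I - D^{ -1/2}AD^{ -1/2}$, whose eigenvalues lie in $[0,2]$, with $0$ of multiplicity equal to the number of connected components; the spectral gap is the second smallest eigenvalue $\lambda_2$ of $\mathcal L$.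
   Formalization: The formal theorem adds the hypothesis ε ≤ Δ(G); without an upper bound on ε the claim is false (for K_{n,n} and ε → ∞ the logarithm makes the bound exceed the gap 1), and for ε ≥ Δ(G) the discrepancy condition holds for every graph. -}

module Defs where

open import Algebra.Bundles using (CommutativeRing)
import Algebra.Definitions.RawMonoid as RawMonoid
open import Data.Bool.Base using (Bool; true; false; if_then_else_)
open import Data.Fin.Base using (Fin)
open import Data.Fin.Properties using (_≟_)
open import Data.Fin.Subset using (Subset; _∈_; _∉_; _∩_; ∣_∣; Nonempty; ⊤; ⁅_⁆)
open import Data.Fin.Subset.Properties
  using (_∈?_; ∈⊤; p⊆q⇒∣p∣≤∣q∣; ∣⁅x⁆∣≡1; x∈⁅y⁆⇒x≡y)
open import Data.List.Base using (List; _∷_; map; filter; allFin; foldr)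
open import Data.List.Extrema.Nat using (min; max; v<min⁺; v<max⁺)
open import Data.List.Membership.Propositional as List using ()
open import Data.List.Membership.Propositional.Properties
  using (∈-allFin; ∈-filter⁺)
open import Data.List.Relation.Unary.All as All using ()
open import Data.List.Relation.Unary.All.Properties as All using ()
open import Data.List.Relation.Unary.Any as Any using ()
open import Data.List.Relation.Unary.Any.Properties as Any using ()
open import Data.Nat.Base as ℕ using (ℕ; zero; suc; NonZero; >-nonZero)
import Data.Nat.Properties as ℕ
open import Data.Nat.ListAction using (sum)
open import Data.Product.Base using (∃-syntax; _×_; _,_; proj₁; proj₂)
open import Data.Sum.Base using (_⊎_; inj₁; inj₂)
open import Data.Vec.Base using (tabulate)
open import Data.Vec.Properties using (lookup⇒[]=; lookup∘tabulate)
open import Level using (Level; _⊔_) renaming (suc to lsuc)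
open import Relation.Binary.Construct.Closure.ReflexiveTransitive using (Star; ε; _◅_)
open import Relation.Binary.Core using (Rel)
open import Relation.Binary.Definitions using (Cotransitive)
open import Relation.Binary.Structures using (IsStrictPartialOrder)
open import Relation.Binary.PropositionalEquality as ≡ using (_≡_)
open import Relation.Nullary.Decidable.Core using (does)
open import Relation.Nullary.Negation using (¬_; contradiction)

------------------------------------------------------------------------
-- Real numbers
------------------------------------------------------------------------

-- Cauchy complete Archimedean ordered fields, with their square root and
-- natural logarithm.  Classically ℝ is, up to isomorphism, the only
-- instance.  The axioms are phrased so that they hold constructively as
-- well: linearity of the order is cotransitivity together with tightness,
-- and only elements known to be positive are inverted (inverses of
-- negative elements follow by negation).

record RealNumbers (c ℓ₁ ℓ₂ : Level) : Set (lsuc (c ⊔ ℓ₁ ⊔ ℓ₂)) where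
  infix 4 _<_ _≤_
  field
    commutativeRing : CommutativeRing c ℓ₁

  open CommutativeRing commutativeRing public

  field
    _<_                  : Rel Carrier ℓ₂
    isStrictPartialOrder : IsStrictPartialOrder _≈_ _<_

  _≤_ : Rel Carrier ℓ₂
  x ≤ y = ¬ (y < x)

  fromℕ : ℕ → Carrier
  fromℕ n = RawMonoid._×_ +-rawMonoid n 1#

  -- |sₘ − sₙ| < e, split into its two halves; the other half is obtained
  -- by exchanging m and n.
  Cauchy : (ℕ → Carrier) → Set (c ⊔ ℓ₂)
  Cauchy s = ∀ {e} → 0# < e →
    ∃[ k ] (∀ m n → k ℕ.≤ m → k ℕ.≤ n → s m < s n + e)

  _ConvergesTo_ : (ℕ → Carrier) → Carrier → Set (c ⊔ ℓ₂)
  s ConvergesTo x = ∀ {e} → 0# < e →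
    ∃[ k ] (∀ n → k ℕ.≤ n → (s n < x + e) × (x < s n + e))

  field
    <-cotrans   : Cotransitive _<_
    ≤-antisym   : ∀ {x y} → x ≤ y → y ≤ x → x ≈ y
    0<1         : 0# < 1#
    +-monoˡ-<   : ∀ z {x y} → x < y → x + z < y + z
    *-pos       : ∀ {x y} → 0# < x → 0# < y → 0# < x * y
    inverse     : ∀ x → 0# < x → ∃[ y ] (0# < y × x * y ≈ 1#)
    archimedean : ∀ x → ∃[ n ] x < fromℕ n
    complete    : ∀ s → Cauchy s → ∃[ x ] s ConvergesTo x

    -- The value at negative arguments is unconstrained.
    √        : Carrier → Carrier
    √-nonneg : ∀ {x} → 0# ≤ x → 0# ≤ √ x
    √-square : ∀ {x} → 0# ≤ x → √ x * √ x ≈ x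

    -- Additivity gives n * log x^(1/n) = log x, and log-≤ bounds this by
    -- n (x^(1/n) − 1); applied to x and to 1/x, the limit n → ∞ leaves the
    -- natural logarithm as the only possibility.
    log      : ∀ x → 0# < x → Carrier
    log-cong : ∀ {x y} p q → x ≈ y → log x p ≈ log y q
    log-*    : ∀ {x y} p q r → log (x * y) r ≈ log x p + log y q
    log-≤    : ∀ {x} p → log x p ≤ x - 1#

  ∣_∣≤_ : Rel Carrier ℓ₂
  ∣ x ∣≤ y = (x ≤ y) × (- x ≤ y)
  infix 4 ∣_∣≤_

  infixl 7 _/_∵_ _/ℕ_
  _/_∵_ : ∀ (x y : Carrier) → 0# < y → Carrier
  x / y ∵ 0<y = x * proj₁ (inverse y 0<y)

  open IsStrictPartialOrder isStrictPartialOrder public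
    using () renaming (irrefl to <-irrefl; trans to <-trans; <-resp-≈ to <-resp-≈)

  ∑ : ∀ {n} → (Fin n → Carrier) → Carrier
  ∑ = RawMonoid.sum +-rawMonoid

  +-pos : ∀ {x y} → 0# < x → 0# < y → 0# < x + y
  +-pos {x} {y} 0<x 0<y =
    <-trans 0<y (proj₂ <-resp-≈ (+-identityˡ y) (+-monoˡ-< y 0<x))

  fromℕ-pos : ∀ n → .{{NonZero n}} → 0# < fromℕ n
  fromℕ-pos (suc zero)    = proj₁ <-resp-≈ (sym (+-identityʳ 1#)) 0<1
  fromℕ-pos (suc (suc n)) = +-pos 0<1 (fromℕ-pos (suc n))

  _/ℕ_ : Carrier → (n : ℕ) → .{{NonZero n}} → Carrier
  x /ℕ n = x / fromℕ n ∵ fromℕ-pos n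

  /-pos : ∀ {x y} → 0# < x → (0<y : 0# < y) → 0# < x / y ∵ 0<y
  /-pos 0<x 0<y = *-pos 0<x (proj₁ (proj₂ (inverse _ 0<y)))

------------------------------------------------------------------------
-- Graphs
------------------------------------------------------------------------

elements : ∀ {n} → Subset n → List (Fin n)
elements S = filter (_∈? S) (allFin _)

record Graph (n : ℕ) : Set where
  field
    adj        : Fin n → Fin n → Bool
    adj-sym    : ∀ u v → adj u v ≡ adj v u
    adj-irrefl : ∀ v → adj v v ≡ false

  Adjacent : Fin n → Fin n → Set
  Adjacent u v = adj u v ≡ true

  Connected : Set
  Connected = ∀ u v → Star Adjacent u v

  neighbours : Fin n → Subset n
  neighbours v = tabulate (adj v)

  degree : Fin n → ℕ
  degree v = ∣ neighbours v ∣

  -- Counts ordered pairs (u , v) ∈ U × V with u adjacent to v; for disjoint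
  -- U and V this is the number of edges between them.
  e : Subset n → Subset n → ℕ
  e U V = sum (map (λ u → ∣ neighbours u ∩ V ∣) (elements U))

  degrees : Subset n → List ℕ
  degrees S = map degree (elements S)

  -- The default value n exceeds every degree, so it is only attained for
  -- S = ∅.
  δ[_] : Subset n → ℕ
  δ[ S ] = min n (degrees S)

  δ Δ : ℕ
  δ = δ[ ⊤ ]
  Δ = max 0 (degrees ⊤)

record IsBipartition {n} (G : Graph n) (X Y : Subset n) : Set where
  open Graph G
  field
    cover    : ∀ v → v ∈ X ⊎ v ∈ Y
    disjoint : ∀ {v} → v ∈ X → v ∉ Y
    X⇒Y      : ∀ {u v} → Adjacent u v → u ∈ X → v ∈ Y
    Y⇒X      : ∀ {u v} → Adjacent u v → u ∈ Y → v ∈ X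

-- Both parts are nonempty, as the average degrees (and, for a connected
-- graph, the second smallest eigenvalue) make no sense otherwise.
record ConnectedBipartiteGraph : Set where
  field
    {n}           : ℕ
    graph         : Graph n
    X Y           : Subset n
    isBipartition : IsBipartition graph X Y
    X-nonempty    : Nonempty X
    Y-nonempty    : Nonempty Y
    connected     : Graph.Connected graph

  open Graph graph public
  open IsBipartition isBipartition public

  private
    ∈⇒∣∣>0 : ∀ {S : Subset n} {v} → v ∈ S → 0 ℕ.< ∣ S ∣
    ∈⇒∣∣>0 {S} {v} v∈S = ≡.subst (ℕ._≤ ∣ S ∣) (∣⁅x⁆∣≡1 v)
      (p⊆q⇒∣p∣≤∣q∣ λ w∈⁅v⁆ → ≡.subst (_∈ S) (≡.sym (x∈⁅y⁆⇒x≡y v w∈⁅v⁆)) v∈S)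

    adjacent⇒degree>0 : ∀ {u v} → Adjacent u v → 0 ℕ.< degree u
    adjacent⇒degree>0 {u} {v} uv =
      ∈⇒∣∣>0 {neighbours u} (lookup⇒[]= v _ (≡.trans (lookup∘tabulate (adj u) v) uv))

    leaves : ∀ {u v} → ¬ (u ≡ v) → Star Adjacent u v → 0 ℕ.< degree u
    leaves u≢v ε        = contradiction ≡.refl u≢v
    leaves u≢v (uw ◅ _) = adjacent⇒degree>0 uw

  degree>0 : ∀ v → 0 ℕ.< degree v
  degree>0 v with cover v
  ... | inj₁ v∈X = leaves (λ { ≡.refl → disjoint v∈X (proj₂ Y-nonempty) })
                          (connected v (proj₁ Y-nonempty))
  ... | inj₂ v∈Y = leaves (λ { ≡.refl → disjoint (proj₂ X-nonempty) v∈Y })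
                          (connected v (proj₁ X-nonempty))

  private
    n>0 : 0 ℕ.< n
    n>0 = go (proj₁ X-nonempty)
      where
      go : ∀ {m} → Fin m → 0 ℕ.< m
      go {suc _} _ = ℕ.z<s

    δ[]>0 : ∀ S → 0 ℕ.< δ[ S ]
    δ[]>0 S = v<min⁺ {xs = degrees S} n>0 (All.map⁺ (All.tabulate λ {v} _ → degree>0 v))

    ∈-elements : ∀ {S : Subset n} {v} → v ∈ S → v List.∈ elements S
    ∈-elements v∈S = ∈-filter⁺ (_∈? _) (∈-allFin _) v∈S

    Δ>0 : 0 ℕ.< Δ
    Δ>0 = v<max⁺ 0 (degrees ⊤) (inj₂ (Any.map⁺
            (Any.map (λ {v} _ → degree>0 v) (∈-elements (∈⊤ {x = proj₁ X-nonempty})))))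

    sum>0 : ∀ {vs : List (Fin n)} {v} → v List.∈ vs → 0 ℕ.< sum (map degree vs)
    sum>0 {w ∷ _} _ = ℕ.<-≤-trans (degree>0 w) (ℕ.m≤m+n _ _)

  instance
    ∣X∣-nonZero : NonZero ∣ X ∣
    ∣X∣-nonZero = >-nonZero (∈⇒∣∣>0 (proj₂ X-nonempty))

    ∣Y∣-nonZero : NonZero ∣ Y ∣
    ∣Y∣-nonZero = >-nonZero (∈⇒∣∣>0 (proj₂ Y-nonempty))

    degree-nonZero : ∀ {v} → NonZero (degree v)
    degree-nonZero {v} = >-nonZero (degree>0 v)

    δ[]-nonZero : ∀ {S} → NonZero δ[ S ]
    δ[]-nonZero {S} = >-nonZero (δ[]>0 S)

    Δ-nonZero : NonZero Δ
    Δ-nonZero = >-nonZero Δ>0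

    degreeSumX-nonZero : NonZero (sum (degrees X))
    degreeSumX-nonZero = >-nonZero (sum>0 (∈-elements (proj₂ X-nonempty)))

    degreeSumY-nonZero : NonZero (sum (degrees Y))
    degreeSumY-nonZero = >-nonZero (sum>0 (∈-elements (proj₂ Y-nonempty)))

------------------------------------------------------------------------
-- Eigenvalues
------------------------------------------------------------------------

module Eigenvalues {c ℓ₁ ℓ₂} (ℝ : RealNumbers c ℓ₁ ℓ₂) {n : ℕ} where
  open RealNumbers ℝ

  Vector : Set c
  Vector = Fin n → Carrier

  Matrix : Set c
  Matrix = Fin n → Fin n → Carrier

  IsEigenpair : Matrix → Carrier → Vector → Set ℓ₁
  IsEigenpair M μ v = ∀ i → ∑ (λ j → M i j * v j) ≈ μ * v i

  LinearlyIndependent : Vector → Vector → Set (c ⊔ ℓ₁)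
  LinearlyIndependent v w =
    ∀ a b → (∀ i → a * v i + b * w i ≈ 0#) → (a ≈ 0#) × (b ≈ 0#)

  -- μ₁ ≤ μ₂ are two entries of the list of eigenvalues in which every
  -- eigenvalue is repeated according to the dimension of its eigenspace.
  AreTwoEigenvalues : Matrix → Carrier → Carrier → Set (c ⊔ ℓ₁ ⊔ ℓ₂)
  AreTwoEigenvalues M μ₁ μ₂ = (μ₁ ≤ μ₂) × ∃[ v₁ ] ∃[ v₂ ]
    (LinearlyIndependent v₁ v₂ × IsEigenpair M μ₁ v₁ × IsEigenpair M μ₂ v₂)

  -- Counted with multiplicity.
  IsSecondSmallestEigenvalue : Matrix → Carrier → Set (c ⊔ ℓ₁ ⊔ ℓ₂)
  IsSecondSmallestEigenvalue M λ₂ =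
    (∃[ λ₁ ] AreTwoEigenvalues M λ₁ λ₂) ×
    (∀ μ₁ μ₂ → AreTwoEigenvalues M μ₁ μ₂ → λ₂ ≤ μ₂)

------------------------------------------------------------------------
-- Real invariants of a connected bipartite graph
------------------------------------------------------------------------

module Invariants {c ℓ₁ ℓ₂} (ℝ : RealNumbers c ℓ₁ ℓ₂) (G : ConnectedBipartiteGraph) where
  open RealNumbers ℝ
  open ConnectedBipartiteGraph G
  open Eigenvalues ℝ {n}

  averageDegree : (S : Subset n) → .{{NonZero ∣ S ∣}} → Carrier
  averageDegree S = fromℕ (sum (degrees S)) /ℕ ∣ S ∣

  -- The population standard deviation √(1/|S| ∑ (deg s − avg)²).
  degreeDeviation : (S : Subset n) → .{{NonZero ∣ S ∣}} → Carrier
  degreeDeviation S = √ (foldr _+_ 0# (map squareDev (elements S)) /ℕ ∣ S ∣)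
    where
    squareDev : Fin n → Carrier
    squareDev s = (fromℕ (degree s) - averageDegree S) * (fromℕ (degree s) - averageDegree S)

  d̄ c̄ σX σY : Carrier
  d̄  = averageDegree X
  c̄  = averageDegree Y
  σX = degreeDeviation X
  σY = degreeDeviation Y

  identity adjacency normalizedLaplacian : Matrix
  identity  u v = if does (u ≟ v) then 1# else 0#
  adjacency u v = if adj u v then 1# else 0#
  normalizedLaplacian u v =
    identity u v - √ (1# /ℕ degree u) * adjacency u v * √ (1# /ℕ degree v)

  IsSpectralGap : Carrier → Set (c ⊔ ℓ₁ ⊔ ℓ₂)
  IsSpectralGap = IsSecondSmallestEigenvalue normalizedLaplacian

  -- Both numbers being compared lie between 0 and Δ √(|U||V|), so this says
  -- nothing about G once Δ ≤ ϵ.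
  Discrepancy≤ : Carrier → Set ℓ₂
  Discrepancy≤ ϵ = ∀ (U V : Subset n) → (∀ {v} → v ∈ U → v ∈ X) → (∀ {v} → v ∈ V → v ∈ Y) →
    ∣ fromℕ (e U V) - (fromℕ ∣ U ∣ * fromℕ ∣ V ∣ * c̄) /ℕ ∣ X ∣ ∣≤ ϵ * √ (fromℕ ∣ U ∣ * fromℕ ∣ V ∣)

  logRatio : (ϵ : Carrier) → 0# < ϵ → Carrier
  logRatio ϵ 0<ϵ = log ((fromℕ Δ + d̄ + c̄) / ϵ ∵ 0<ϵ) (/-pos numerator>0 0<ϵ)
    where
    average>0 : ∀ m k → .{{_ : NonZero m}} → .{{_ : NonZero k}} → 0# < fromℕ m /ℕ k
    average>0 m k = /-pos (fromℕ-pos m) (fromℕ-pos k)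

    numerator>0 : 0# < fromℕ Δ + d̄ + c̄
    numerator>0 = +-pos (+-pos (fromℕ-pos Δ) (average>0 (sum (degrees X)) ∣ X ∣))
                        (average>0 (sum (degrees Y)) ∣ Y ∣)

  gapBound : (C ϵ : Carrier) → 0# < ϵ → Carrier
  gapBound C ϵ 0<ϵ =
    1# - (C * ϵ * logRatio ϵ 0<ϵ + C) /ℕ δ
       - (fromℕ 2 * σX * σY) / (fromℕ δ[ X ] * fromℕ δ[ Y ])
           ∵ *-pos (fromℕ-pos δ[ X ]) (fromℕ-pos δ[ Y ])

{-# OPTIONS --safe #-}
module Submission where

-- By the min-max principle it suffices to bound the adjacency form on vectors h whose sum over Y
-- vanishes.  There the constant matrix p = c̄ / |X|, the density of G, contributes nothing, so the adjacency
-- form is twice that of E = A − p on X × Y.  This gives the bound even without the deviation term,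
-- which is only used to be nonnegative.
--
-- For vectors with natural entries, split f = ∑ 2^k 1_{U_k} and g = ∑ 2^l 1_{V_l} into binary digits.
-- The discrepancy bounds 2^(k+l) E(U_k, V_l) by ϵ (4^k |U_k| + 4^l |V_l|), which is used for |k − l| < L;
-- for the other pairs the trivial bounds K |U_k| and K |V_l|, where K = Δ + d̄ + c̄ ≤ 2^L ϵ, decay
-- geometrically in |k − l|.  As ∑ 4^k |U_k| ≤ |f|², the form of E is at most (2L + 2) ϵ (|f|² + |g|²).
-- Scaling and rounding extends this to nonnegative real vectors, and splitting into positive and
-- negative parts to all of them.  Finally L = O(log (K / ϵ)) unless K / ϵ < 4, when the claimed bound is
-- at most 0 because ϵ ≤ Δ.

open import Defs
open import Algebra.Bundles using (CommutativeRing)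
import Algebra.Properties.AbelianGroup
import Algebra.Properties.Ring
import Algebra.Properties.Semiring.Mult
import Algebra.Properties.Semiring.Mult.TCOptimised
import Algebra.Properties.Semiring.Sum
import Algebra.Solver.Ring
open import Algebra.Solver.Ring.AlmostCommutativeRing
  using (fromCommutativeRing; _-Raw-AlmostCommutative⟶_)
open import Data.Bool.Base using (Bool; true; false; _∧_; not; if_then_else_)
open import Data.Fin.Base using (Fin; zero; suc; toℕ)
open import Data.Fin.Properties using (_≟_)
open import Data.Fin.Subset using (Subset; _∈_; _∩_; ⊤)
open import Data.Fin.Subset.Properties using (_∈?_; ∈⊤; p⊆q⇒∣p∣≤∣q∣)
open import Data.Integer.Base as ℤ using (ℤ; -[1+_]; _⊖_)
import Data.Integer.Properties as ℤ
open import Data.List.Base as List using ([]; _∷_; map; filter; foldr)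
open import Data.List.Extrema.Nat using (min≤v⁺; v≤max⁺)
open import Data.List.Membership.Propositional using () renaming (_∈_ to _∈ˡ_)
open import Data.List.Membership.Propositional.Properties using (∈-allFin; ∈-filter⁺; ∈-map⁺)
open import Data.List.Relation.Unary.Any as Any using ()
open import Data.Maybe.Base using (Maybe; just; nothing)
open import Data.Nat.Base as ℕ using (ℕ; zero; suc; z≤n; s≤s; NonZero)
open import Data.Nat.ListAction using () renaming (sum to sumˡ)
import Data.Nat.Properties as ℕ
open import Data.Nat.Solver using () renaming (module +-*-Solver to ℕ-Solver)
open import Data.Product.Base using (∃-syntax; _×_; _,_; proj₁; proj₂)
open import Data.Sum.Base using (inj₁; inj₂; [_,_]′)
open import Data.Vec.Base using ([]; _∷_; lookup; tabulate)
open import Data.Vec.Properties using (lookup∘tabulate; lookup-zipWith; []=⇒lookup; lookup⇒[]=)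
open import Function.Base using (_∘_; id)
open import Relation.Binary.PropositionalEquality as ≡ using (_≡_)
import Relation.Binary.Reasoning.Base.Triple
import Relation.Binary.Reasoning.Setoid
open import Relation.Binary.Structures using (IsPreorder)
open import Relation.Nullary.Decidable.Core using (yes; no; does)
open import Relation.Nullary.Negation using (¬_; contradiction)
open import Relation.Nullary.Reflects using (ofʸ; ofⁿ)

-- The discrepancy controls indicator vectors only, and summing it over all pairs of digits would
-- cost a factor equal to the number of digits, which is unbounded. The logarithm is the price of
-- avoiding this: a digit of one vector interacts at full strength with fewer than 2L digits of the
-- other, and the trivial bounds make the rest a convergent geometric series.
--
-- The order is merely cotransitive, which shapes the remaining steps. Binary digits of a real
-- number cannot be computed, so they are taken of natural entries only; for real entries the
-- rounding error is linear in the scale while the form is quadratic, and the Archimedean axiom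
-- removes it. An inequality x ≤ y is a negation, so case distinctions remain available when the
-- goal is such an inequality. The min-max argument likewise stays inside the span of the two given
-- eigenvectors and never decides whether a coefficient vanishes.

module ℕ-Sum = Algebra.Properties.Semiring.Sum ℕ.+-*-semiring

-- Ring identities with integer coefficients

module ℤ-Solver {c ℓ} (R : CommutativeRing c ℓ) where
  open import Data.Integer.Base public using (+_; -1ℤ)
  open CommutativeRing R
  open Algebra.Properties.Ring ring
  open Algebra.Properties.AbelianGroup +-abelianGroup using (⁻¹-∙-comm)
  open Algebra.Properties.Semiring.Mult.TCOptimised semiring
    using (1+×; ×-homo-+; ×1-homo-*) renaming (_×_ to _·_)
  open Relation.Binary.Reasoning.Setoid setoid

  -- The solver compares coefficients, so these are taken from ℤ, where equality is decidable, and
  -- mapped into the ring by its canonical homomorphism.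
  ⟦_⟧ᶻ : ℤ → Carrier
  ⟦ + n ⟧ᶻ      = n · 1#
  ⟦ -[1+ n ] ⟧ᶻ = - (suc n · 1#)

  ⟦-⟧ : ∀ n → ⟦ ℤ.- (+ n) ⟧ᶻ ≈ - (n · 1#)
  ⟦-⟧ zero    = sym -0#≈0#
  ⟦-⟧ (suc n) = refl

  ⟦⊖⟧ : ∀ m n → ⟦ m ⊖ n ⟧ᶻ ≈ m · 1# - n · 1#
  ⟦⊖⟧ zero    zero    = sym (-‿inverseʳ 0#)
  ⟦⊖⟧ zero    (suc n) = sym (+-identityˡ _)
  ⟦⊖⟧ (suc m) zero    = sym (trans (+-congˡ -0#≈0#) (+-identityʳ _))
  ⟦⊖⟧ (suc m) (suc n) = begin
    ⟦ suc m ⊖ suc n ⟧ᶻ                       ≡⟨ ≡.cong ⟦_⟧ᶻ (ℤ.[1+m]⊖[1+n]≡m⊖n m n) ⟩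
    ⟦ m ⊖ n ⟧ᶻ                               ≈⟨ ⟦⊖⟧ m n ⟩
    m · 1# - n · 1#                          ≈⟨ +-congˡ (+-identityˡ _) ⟨
    m · 1# + (0# - n · 1#)                   ≈⟨ +-congˡ (+-congʳ (-‿inverseʳ 1#)) ⟨
    m · 1# + ((1# - 1#) - n · 1#)            ≈⟨ +-congˡ (+-assoc _ _ _) ⟩
    m · 1# + (1# + (- 1# - n · 1#))          ≈⟨ +-assoc _ _ _ ⟨
    (m · 1# + 1#) + (- 1# - n · 1#)          ≈⟨ +-cong (+-comm _ _) (⁻¹-∙-comm _ _) ⟩
    (1# + m · 1#) - (1# + n · 1#)            ≈⟨ +-cong (1+× m 1#) (-‿cong (1+× n 1#)) ⟨
    suc m · 1# - suc n · 1#                  ∎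

  +-homo : ∀ i j → ⟦ i ℤ.+ j ⟧ᶻ ≈ ⟦ i ⟧ᶻ + ⟦ j ⟧ᶻ
  +-homo (+ m)      (+ n)      = ×-homo-+ 1# m n
  +-homo (+ m)      -[1+ n ]   = ⟦⊖⟧ m (suc n)
  +-homo -[1+ m ]   (+ n)      = trans (⟦⊖⟧ n (suc m)) (+-comm _ _)
  +-homo -[1+ m ]   -[1+ n ]   = begin
    - (suc (suc (m ℕ.+ n)) · 1#)        ≡⟨ ≡.cong (λ k → - (suc k · 1#)) (ℕ.+-suc m n) ⟨
    - ((suc m ℕ.+ suc n) · 1#)          ≈⟨ -‿cong (×-homo-+ 1# (suc m) (suc n)) ⟩
    - (suc m · 1# + suc n · 1#)         ≈⟨ ⁻¹-∙-comm _ _ ⟨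
    - (suc m · 1#) - suc n · 1#         ∎

  *-homo : ∀ i j → ⟦ i ℤ.* j ⟧ᶻ ≈ ⟦ i ⟧ᶻ * ⟦ j ⟧ᶻ
  *-homo (+ m)    (+ n)    = begin
    ⟦ + m ℤ.* + n ⟧ᶻ         ≡⟨ ≡.cong ⟦_⟧ᶻ (ℤ.pos-* m n) ⟨
    (m ℕ.* n) · 1#           ≈⟨ ×1-homo-* m n ⟩
    m · 1# * (n · 1#)        ∎
  *-homo (+ m)    -[1+ n ] = begin
    ⟦ + m ℤ.* -[1+ n ] ⟧ᶻ         ≡⟨ ≡.cong ⟦_⟧ᶻ (ℤ.neg-distribʳ-* (+ m) (+ suc n)) ⟨
    ⟦ ℤ.- (+ m ℤ.* + suc n) ⟧ᶻ    ≡⟨ ≡.cong (⟦_⟧ᶻ ∘ ℤ.-_) (ℤ.pos-* m (suc n)) ⟨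
    ⟦ ℤ.- (+ (m ℕ.* suc n)) ⟧ᶻ    ≈⟨ ⟦-⟧ (m ℕ.* suc n) ⟩
    - ((m ℕ.* suc n) · 1#)        ≈⟨ -‿cong (×1-homo-* m (suc n)) ⟩
    - (m · 1# * (suc n · 1#))     ≈⟨ -‿distribʳ-* _ _ ⟩
    m · 1# * - (suc n · 1#)       ∎
  *-homo -[1+ m ] (+ n)    = begin
    ⟦ -[1+ m ] ℤ.* + n ⟧ᶻ         ≡⟨ ≡.cong ⟦_⟧ᶻ (ℤ.neg-distribˡ-* (+ suc m) (+ n)) ⟨
    ⟦ ℤ.- (+ suc m ℤ.* + n) ⟧ᶻ    ≡⟨ ≡.cong (⟦_⟧ᶻ ∘ ℤ.-_) (ℤ.pos-* (suc m) n) ⟨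
    ⟦ ℤ.- (+ (suc m ℕ.* n)) ⟧ᶻ    ≈⟨ ⟦-⟧ (suc m ℕ.* n) ⟩
    - ((suc m ℕ.* n) · 1#)        ≈⟨ -‿cong (×1-homo-* (suc m) n) ⟩
    - (suc m · 1# * (n · 1#))     ≈⟨ -‿distribˡ-* _ _ ⟩
    - (suc m · 1#) * (n · 1#)     ∎
  *-homo -[1+ m ] -[1+ n ] = begin
    (suc m ℕ.* suc n) · 1#               ≈⟨ ×1-homo-* (suc m) (suc n) ⟩
    suc m · 1# * (suc n · 1#)            ≈⟨ -‿involutive _ ⟨
    - - (suc m · 1# * (suc n · 1#))      ≈⟨ -‿cong (-‿distribˡ-* _ _) ⟩
    - (- (suc m · 1#) * (suc n · 1#))    ≈⟨ -‿distribʳ-* _ _ ⟩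
    - (suc m · 1#) * - (suc n · 1#)      ∎

  -‿homo : ∀ i → ⟦ ℤ.- i ⟧ᶻ ≈ - ⟦ i ⟧ᶻ
  -‿homo (+ n)      = ⟦-⟧ n
  -‿homo -[1+ n ]   = sym (-‿involutive _)

  morphism : ℤ.+-*-rawRing -Raw-AlmostCommutative⟶ fromCommutativeRing R
  morphism = record
    { ⟦_⟧    = ⟦_⟧ᶻ
    ; +-homo = +-homo
    ; *-homo = *-homo
    ; -‿homo = -‿homo
    ; 0-homo = refl
    ; 1-homo = refl
    }

  _coeff≟_ : ∀ i j → Maybe (⟦ i ⟧ᶻ ≈ ⟦ j ⟧ᶻ)
  i coeff≟ j with i ℤ.≟ j
  ... | yes ≡.refl = just refl
  ... | no _       = nothing

  open Algebra.Solver.Ring ℤ.+-*-rawRing (fromCommutativeRing R) morphism _coeff≟_ public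
    using (solve; _:=_; _:+_; _:*_; :-_; _:-_; con)

-- Arithmetic in a constructive ordered field

module OrderedFieldProperties {c ℓ₁ ℓ₂} (ℝ : RealNumbers c ℓ₁ ℓ₂) where
  open RealNumbers ℝ hiding (zero)
  open ℤ-Solver commutativeRing public
    using (solve; _:=_; _:+_; _:*_; :-_; _:-_; con; +_; -1ℤ)
  private
    module Mult = Algebra.Properties.Semiring.Mult semiring
  open Algebra.Properties.Semiring.Sum semiring public
    using (sum-cong-≋; ∑-distrib-+; ∑-comm; *-distribˡ-sum; *-distribʳ-sum)

  <-asym : ∀ {x y} → x < y → ¬ (y < x)
  <-asym x<y y<x = <-irrefl refl (<-trans x<y y<x)

  <-respˡ : ∀ {x y z} → x ≈ y → x < z → y < z
  <-respˡ = proj₂ <-resp-≈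

  <-respʳ : ∀ {x y z} → y ≈ z → x < y → x < z
  <-respʳ = proj₁ <-resp-≈

  <⇒≤ : ∀ {x y} → x < y → x ≤ y
  <⇒≤ = <-asym

  ≤-reflexive : ∀ {x y} → x ≈ y → x ≤ y
  ≤-reflexive x≈y = <-irrefl (sym x≈y)

  ≤-refl : ∀ {x} → x ≤ x
  ≤-refl = ≤-reflexive refl

  <-≤-trans : ∀ {x y z} → x < y → y ≤ z → x < z
  <-≤-trans {z = z} x<y y≤z with <-cotrans x<y z
  ... | inj₁ x<z = x<z
  ... | inj₂ z<y = contradiction z<y y≤z

  ≤-<-trans : ∀ {x y z} → x ≤ y → y < z → x < z
  ≤-<-trans {x} x≤y y<z with <-cotrans y<z x
  ... | inj₁ y<x = contradiction y<x x≤y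
  ... | inj₂ x<z = x<z

  ≤-trans : ∀ {x y z} → x ≤ y → y ≤ z → x ≤ z
  ≤-trans x≤y y≤z z<x = y≤z (<-≤-trans z<x x≤y)

  ≤-isPreorder : IsPreorder _≈_ _≤_
  ≤-isPreorder = record
    { isEquivalence = isEquivalence
    ; reflexive     = ≤-reflexive
    ; trans         = ≤-trans
    }

  module ≤-Reasoning = Relation.Binary.Reasoning.Base.Triple ≤-isPreorder
    <-asym <-trans <-resp-≈ <⇒≤ <-≤-trans ≤-<-trans

  open ≤-Reasoning

  -- The order is not decidable, but the goal is a negation: given `b < a`, the function `g` refutes
  -- `y < x`, and this refutation is the hypothesis `x ≤ y` that `f` expects.
  ≤-cases : ∀ {x y a b} → (x ≤ y → a ≤ b) → (y ≤ x → a ≤ b) → a ≤ b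
  ≤-cases f g b<a = f (λ y<x → g (<⇒≤ y<x) b<a) b<a

  x<y⇒0<y-x : ∀ {x y} → x < y → 0# < y - x
  x<y⇒0<y-x {x} x<y = <-respˡ (-‿inverseʳ x) (+-monoˡ-< (- x) x<y)

  0<y-x⇒x<y : ∀ {x y} → 0# < y - x → x < y
  0<y-x⇒x<y {x} {y} 0<y-x = <-respˡ (+-identityˡ x)
    (<-respʳ (solve 2 (λ x y → (y :- x) :+ x := y) refl x y) (+-monoˡ-< x 0<y-x))

  0≤y-x⇒x≤y : ∀ {x y} → 0# ≤ y - x → x ≤ y
  0≤y-x⇒x≤y {x} {y} 0≤y-x y<x = 0≤y-x (<-respʳ (-‿inverseʳ x)
    (<-respˡ refl (+-monoˡ-< (- x) y<x)))

  x≤y⇒0≤y-x : ∀ {x y} → x ≤ y → 0# ≤ y - x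
  x≤y⇒0≤y-x {x} {y} x≤y y-x<0 = x≤y (<-respˡ (solve 2 (λ x y → (y :- x) :+ x := y) refl x y)
    (<-respʳ (+-identityˡ x) (+-monoˡ-< x y-x<0)))

  ≤-from-diff : ∀ {x y e} → 0# ≤ e → e ≈ y - x → x ≤ y
  ≤-from-diff 0≤e e≈y-x = 0≤y-x⇒x≤y (≤-trans 0≤e (≤-reflexive e≈y-x))

  +-monoˡ-≤ : ∀ z {x y} → x ≤ y → x + z ≤ y + z
  +-monoˡ-≤ z {x} {y} x≤y = ≤-from-diff (x≤y⇒0≤y-x x≤y)
    (solve 3 (λ x y z → y :- x := (y :+ z) :- (x :+ z)) refl x y z)

  +-monoʳ-≤ : ∀ z {x y} → x ≤ y → z + x ≤ z + y
  +-monoʳ-≤ z {x} {y} x≤y = begin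
    z + x  ≈⟨ +-comm z x ⟩
    x + z  ≤⟨ +-monoˡ-≤ z x≤y ⟩
    y + z  ≈⟨ +-comm y z ⟩
    z + y  ∎

  +-mono-≤ : ∀ {x y u v} → x ≤ y → u ≤ v → x + u ≤ y + v
  +-mono-≤ {y = y} {u} x≤y u≤v = ≤-trans (+-monoˡ-≤ u x≤y) (+-monoʳ-≤ y u≤v)

  +-nonneg : ∀ {x y} → 0# ≤ x → 0# ≤ y → 0# ≤ x + y
  +-nonneg 0≤x 0≤y = ≤-trans (≤-reflexive (sym (+-identityʳ 0#))) (+-mono-≤ 0≤x 0≤y)

  x≤x+y : ∀ x {y} → 0# ≤ y → x ≤ x + y
  x≤x+y x 0≤y = ≤-trans (≤-reflexive (sym (+-identityʳ x))) (+-monoʳ-≤ x 0≤y)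

  x≤y+x : ∀ x {y} → 0# ≤ y → x ≤ y + x
  x≤y+x x {y} 0≤y = ≤-trans (x≤x+y x 0≤y) (≤-reflexive (+-comm x y))

  x-y≤x : ∀ x {y} → 0# ≤ y → x - y ≤ x
  x-y≤x x {y} 0≤y = ≤-from-diff 0≤y (solve 2 (λ x y → y := x :- (x :- y)) refl x y)

  -‿antimono-≤ : ∀ {x y} → x ≤ y → - y ≤ - x
  -‿antimono-≤ {x} {y} x≤y = ≤-from-diff (x≤y⇒0≤y-x x≤y)
    (solve 2 (λ x y → y :- x := (:- x) :- (:- y)) refl x y)

  x≤0⇒0≤-x : ∀ {x} → x ≤ 0# → 0# ≤ - x
  x≤0⇒0≤-x {x} x≤0 = ≤-from-diff (x≤y⇒0≤y-x x≤0) (solve 1 (λ x → con (+ 0) :- x := (:- x) :- con (+ 0)) refl x)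

  0≤1 : 0# ≤ 1#
  0≤1 = <⇒≤ 0<1

  -- Only the strict rule `*-pos` is an axiom. Since the goal is absurdity, both factors may be
  -- taken to be strictly positive: a nonnegative factor that is also `≤ 0#` equals zero by
  -- tightness, and then so does the product.
  *-nonneg : ∀ {x y} → 0# ≤ x → 0# ≤ y → 0# ≤ x * y
  *-nonneg {x} {y} 0≤x 0≤y xy<0 = ¬0<x λ 0<x → ¬0<y λ 0<y → <-asym xy<0 (*-pos 0<x 0<y)
    where
    ¬0<x : ¬ ¬ (0# < x)
    ¬0<x x≤0 = <-irrefl (trans (*-congʳ (≤-antisym x≤0 0≤x)) (zeroˡ y)) xy<0
    ¬0<y : ¬ ¬ (0# < y)
    ¬0<y y≤0 = <-irrefl (trans (*-congˡ (≤-antisym y≤0 0≤y)) (zeroʳ x)) xy<0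

  *-monoˡ-≤ : ∀ {z x y} → 0# ≤ z → x ≤ y → z * x ≤ z * y
  *-monoˡ-≤ {z} {x} {y} 0≤z x≤y = ≤-from-diff (*-nonneg 0≤z (x≤y⇒0≤y-x x≤y))
    (solve 3 (λ x y z → z :* (y :- x) := z :* y :- z :* x) refl x y z)

  *-monoʳ-≤ : ∀ {z x y} → 0# ≤ z → x ≤ y → x * z ≤ y * z
  *-monoʳ-≤ {z} {x} {y} 0≤z x≤y = begin
    x * z  ≈⟨ *-comm x z ⟩
    z * x  ≤⟨ *-monoˡ-≤ 0≤z x≤y ⟩
    z * y  ≈⟨ *-comm z y ⟩
    y * z  ∎

  *-mono-≤ : ∀ {x y u v} → 0# ≤ y → 0# ≤ u → x ≤ y → u ≤ v → x * u ≤ y * v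
  *-mono-≤ 0≤y 0≤u x≤y u≤v = ≤-trans (*-monoʳ-≤ 0≤u x≤y) (*-monoˡ-≤ 0≤y u≤v)

  *-monoˡ-< : ∀ {z x y} → 0# < z → x < y → z * x < z * y
  *-monoˡ-< {z} {x} {y} 0<z x<y = 0<y-x⇒x<y (<-respʳ
    (solve 3 (λ x y z → z :* (y :- x) := z :* y :- z :* x) refl x y z)
    (*-pos 0<z (x<y⇒0<y-x x<y)))

  *-cancelˡ-≤ : ∀ {z x y} → 0# < z → z * x ≤ z * y → x ≤ y
  *-cancelˡ-≤ 0<z zx≤zy y<x = zx≤zy (*-monoˡ-< 0<z y<x)

  x*x-nonneg : ∀ x → 0# ≤ x * x
  x*x-nonneg x = ≤-cases {0#} {x} (λ 0≤x → *-nonneg 0≤x 0≤x) λ x≤0 →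
    ≤-trans (*-nonneg (x≤0⇒0≤-x x≤0) (x≤0⇒0≤-x x≤0))
      (≤-reflexive (solve 1 (λ x → (:- x) :* (:- x) := x :* x) refl x))

  x*x≤y*y⇒x≤y : ∀ {x y} → 0# ≤ y → x * x ≤ y * y → x ≤ y
  x*x≤y*y⇒x≤y {x} {y} 0≤y xx≤yy y<x = xx≤yy (begin-strict
    y * y  ≤⟨ *-monoʳ-≤ 0≤y (<⇒≤ y<x) ⟩
    x * y  <⟨ *-monoˡ-< (≤-<-trans 0≤y y<x) y<x ⟩
    x * x  ∎)

  x*x≈0⇒x≈0 : ∀ {x} → x * x ≈ 0# → x ≈ 0#
  x*x≈0⇒x≈0 {x} xx≈0 = ≤-antisym (x≤0 x xx≈0)
    (≤-trans (-‿antimono-≤ (x≤0 (- x) (trans (solve 1 (λ x → (:- x) :* (:- x) := x :* x) refl x) xx≈0)))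
             (≤-reflexive (solve 1 (λ x → :- (:- x) := x) refl x))
     ∘ <-respʳ (solve 0 (con (+ 0) := :- con (+ 0)) refl))
    where
    x≤0 : ∀ x → x * x ≈ 0# → x ≤ 0#
    x≤0 x xx≈0 = x*x≤y*y⇒x≤y ≤-refl (≤-reflexive (trans xx≈0 (sym (zeroˡ 0#))))

  2xy≤xx+yy : ∀ x y → x * y + x * y ≤ x * x + y * y
  2xy≤xx+yy x y = ≤-from-diff (x*x-nonneg (x - y))
    (solve 2 (λ x y → (x :- y) :* (x :- y) := (x :* x :+ y :* y) :- (x :* y :+ x :* y)) refl x y)

  -- √ (x * x) spares a case distinction on the sign of x.

  ∣_∣ : Carrier → Carrier
  ∣ x ∣ = √ (x * x)

  ∣x∣-nonneg : ∀ x → 0# ≤ ∣ x ∣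
  ∣x∣-nonneg x = √-nonneg (x*x-nonneg x)

  ∣x∣*∣x∣≈x*x : ∀ x → ∣ x ∣ * ∣ x ∣ ≈ x * x
  ∣x∣*∣x∣≈x*x x = √-square (x*x-nonneg x)

  x≤∣x∣ : ∀ x → x ≤ ∣ x ∣
  x≤∣x∣ x = x*x≤y*y⇒x≤y (∣x∣-nonneg x) (≤-reflexive (sym (∣x∣*∣x∣≈x*x x)))

  -x≤∣x∣ : ∀ x → - x ≤ ∣ x ∣
  -x≤∣x∣ x = x*x≤y*y⇒x≤y (∣x∣-nonneg x) (≤-reflexive
    (trans (solve 1 (λ x → (:- x) :* (:- x) := x :* x) refl x) (sym (∣x∣*∣x∣≈x*x x))))

  -- Natural numbers in the field

  fromℕ-+ : ∀ m n → fromℕ (m ℕ.+ n) ≈ fromℕ m + fromℕ n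
  fromℕ-+ = Mult.×-homo-+ 1#

  fromℕ-* : ∀ m n → fromℕ (m ℕ.* n) ≈ fromℕ m * fromℕ n
  fromℕ-* = Mult.×1-homo-*

  fromℕ-1 : fromℕ 1 ≈ 1#
  fromℕ-1 = +-identityʳ 1#

  fromℕ-nonneg : ∀ n → 0# ≤ fromℕ n
  fromℕ-nonneg zero    = ≤-refl
  fromℕ-nonneg (suc n) = +-nonneg 0≤1 (fromℕ-nonneg n)

  fromℕ-mono-≤ : ∀ {m n} → m ℕ.≤ n → fromℕ m ≤ fromℕ n
  fromℕ-mono-≤ {n = n} z≤n = fromℕ-nonneg n
  fromℕ-mono-≤ (s≤s m≤n)   = +-monoʳ-≤ 1# (fromℕ-mono-≤ m≤n)

  fromℕ-n<1+n : ∀ n → fromℕ n < fromℕ (suc n)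
  fromℕ-n<1+n n = <-respˡ (+-identityˡ _) (+-monoˡ-< (fromℕ n) 0<1)

  -- An approximate floor; the exact one is not computable.
  floor : ∀ x → 0# ≤ x → ∃[ k ] (fromℕ k ≤ x × x ≤ fromℕ k + fromℕ 2)
  floor x 0≤x = let (n , x<n) = archimedean x in below n x<n
    where
    below : ∀ n → x < fromℕ n → ∃[ k ] (fromℕ k ≤ x × x ≤ fromℕ k + fromℕ 2)
    below zero    x<0 = contradiction x<0 0≤x
    below (suc zero) x<1 = 0 , 0≤x , (begin
      x            ≤⟨ <⇒≤ x<1 ⟩
      fromℕ 1      ≤⟨ fromℕ-mono-≤ {1} {2} (s≤s z≤n) ⟩
      fromℕ 2      ≈⟨ +-identityˡ _ ⟨
      0# + fromℕ 2 ∎)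
    -- The intervals (n, n + 2) overlap, so cotransitivity can choose between stopping and
    -- descending; this is the origin of the error 2.
    below (suc (suc n)) x<2+n = [ here , below (suc n) ]′ (<-cotrans (fromℕ-n<1+n n) x)
      where
      here : fromℕ n < x → ∃[ k ] (fromℕ k ≤ x × x ≤ fromℕ k + fromℕ 2)
      here n<x = n , <⇒≤ n<x , (begin
        x                   ≤⟨ <⇒≤ x<2+n ⟩
        fromℕ (2 ℕ.+ n)     ≡⟨ ≡.cong fromℕ (ℕ.+-comm 2 n) ⟩
        fromℕ (n ℕ.+ 2)     ≈⟨ fromℕ-+ n 2 ⟩
        fromℕ n + fromℕ 2   ∎)

  -- This replaces a limit m → ∞: an error that stays bounded while the main term is multiplied by
  -- every `m` forces the main term to be nonpositive.
  multiples-bounded⇒≤0 : ∀ {x b} → (∀ m → fromℕ m * x ≤ b) → x ≤ 0#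
  multiples-bounded⇒≤0 {x} {b} bound 0<x with inverse x 0<x
  ... | y , 0<y , xy≈1 with archimedean (b * y)
  ...   | m , by<m = bound m (begin-strict
    b              ≈⟨ *-identityʳ b ⟨
    b * 1#         ≈⟨ *-congˡ xy≈1 ⟨
    b * (x * y)    ≈⟨ solve 3 (λ b x y → b :* (x :* y) := x :* (b :* y)) refl b x y ⟩
    x * (b * y)    <⟨ *-monoˡ-< 0<x by<m ⟩
    x * fromℕ m    ≈⟨ *-comm x _ ⟩
    fromℕ m * x    ∎)

  /-*-cancel : ∀ x {y} (0<y : 0# < y) → (x / y ∵ 0<y) * y ≈ x
  /-*-cancel x {y} 0<y = let (y⁻¹ , _ , yy⁻¹≈1) = inverse y 0<y in trans
    (solve 3 (λ x y z → (x :* z) :* y := x :* (y :* z)) refl x y y⁻¹)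
    (trans (*-congˡ yy⁻¹≈1) (*-identityʳ x))

  /-nonneg : ∀ {x y} → 0# ≤ x → (0<y : 0# < y) → 0# ≤ x / y ∵ 0<y
  /-nonneg {y = y} 0≤x 0<y = *-nonneg 0≤x (<⇒≤ (proj₁ (proj₂ (inverse y 0<y))))

  ≤/ : ∀ {x y z} (0<z : 0# < z) → x * z ≤ y → x ≤ y / z ∵ 0<z
  ≤/ {x} {y} {z} 0<z xz≤y = *-cancelˡ-≤ 0<z (begin
    z * x                ≈⟨ *-comm z x ⟩
    x * z                ≤⟨ xz≤y ⟩
    y                    ≈⟨ /-*-cancel y 0<z ⟨
    (y / z ∵ 0<z) * z    ≈⟨ *-comm _ z ⟩
    z * (y / z ∵ 0<z)    ∎)

  -- Finite and double sums

  ∑-cong : ∀ {n} {f g : Fin n → Carrier} → (∀ i → f i ≈ g i) → ∑ f ≈ ∑ g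
  ∑-cong = sum-cong-≋

  ∑-mono-≤ : ∀ {n} {f g : Fin n → Carrier} → (∀ i → f i ≤ g i) → ∑ f ≤ ∑ g
  ∑-mono-≤ {zero}  f≤g = ≤-refl
  ∑-mono-≤ {suc n} f≤g = +-mono-≤ (f≤g zero) (∑-mono-≤ (f≤g ∘ suc))

  ∑-nonneg : ∀ {n} {f : Fin n → Carrier} → (∀ i → 0# ≤ f i) → 0# ≤ ∑ f
  ∑-nonneg {zero}  0≤f = ≤-refl
  ∑-nonneg {suc n} 0≤f = +-nonneg (0≤f zero) (∑-nonneg (0≤f ∘ suc))

  ∑-nonneg≈0 : ∀ {n} {f : Fin n → Carrier} → (∀ i → 0# ≤ f i) → ∑ f ≤ 0# → ∀ i → f i ≈ 0#
  ∑-nonneg≈0 {suc n} 0≤f ∑f≤0 zero    =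
    ≤-antisym (≤-trans (x≤x+y _ (∑-nonneg (0≤f ∘ suc))) ∑f≤0) (0≤f zero)
  ∑-nonneg≈0 {suc n} 0≤f ∑f≤0 (suc i) =
    ∑-nonneg≈0 (0≤f ∘ suc) (≤-trans (x≤y+x _ (0≤f zero)) ∑f≤0) i

  ∑∑-mono-≤ : ∀ {m n} {f g : Fin m → Fin n → Carrier} → (∀ i j → f i j ≤ g i j) →
              ∑ (λ i → ∑ (f i)) ≤ ∑ (λ i → ∑ (g i))
  ∑∑-mono-≤ f≤g = ∑-mono-≤ λ i → ∑-mono-≤ (f≤g i)

  ∑∑-cong : ∀ {m n} {f g : Fin m → Fin n → Carrier} → (∀ i j → f i j ≈ g i j) →
            ∑ (λ i → ∑ (f i)) ≈ ∑ (λ i → ∑ (g i))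
  ∑∑-cong f≈g = ∑-cong λ i → ∑-cong (f≈g i)

  ∑∑-distrib-+ : ∀ {m n} (f g : Fin m → Fin n → Carrier) →
    ∑ (λ i → ∑ (λ j → f i j + g i j)) ≈ ∑ (λ i → ∑ (f i)) + ∑ (λ i → ∑ (g i))
  ∑∑-distrib-+ f g = trans (∑-cong λ i → ∑-distrib-+ (f i) (g i)) (∑-distrib-+ (λ i → ∑ (f i)) (λ i → ∑ (g i)))

  *-distribˡ-∑∑ : ∀ {m n} a (f : Fin m → Fin n → Carrier) →
    a * ∑ (λ i → ∑ (f i)) ≈ ∑ (λ i → ∑ (λ j → a * f i j))
  *-distribˡ-∑∑ a f = trans (*-distribˡ-sum a (λ i → ∑ (f i))) (∑-cong λ i → *-distribˡ-sum a (f i))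

  ∑-*-∑ : ∀ {m n} (f : Fin m → Carrier) (g : Fin n → Carrier) →
    ∑ f * ∑ g ≈ ∑ (λ i → ∑ (λ j → f i * g j))
  ∑-*-∑ f g = trans (*-distribʳ-sum (∑ g) f) (∑-cong λ i → *-distribˡ-sum (f i) g)

-- Binary digits and the weights of pairs of digits

module Dyadic where
  open import Data.Nat.Base
  open import Data.Nat.Properties
  open ℕ-Sum
  open ℕ-Solver using (solve; _:=_; _:+_; _:*_; con)
  open ≤-Reasoning
  open ≡ using (refl; cong; cong₂; sym; trans)

  sum-mono-≤ : ∀ {n} {f g : Fin n → ℕ} → (∀ i → f i ≤ g i) → sum f ≤ sum g
  sum-mono-≤ {zero}  f≤g = z≤n
  sum-mono-≤ {suc n} f≤g = +-mono-≤ (f≤g zero) (sum-mono-≤ (f≤g ∘ suc))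

  ≤-sum : ∀ {n} (f : Fin n → ℕ) i → f i ≤ sum f
  ≤-sum f zero    = m≤m+n _ _
  ≤-sum f (suc i) = m≤n⇒m≤o+n (f zero) (≤-sum (f ∘ suc) i)

  𝟙 : Bool → ℕ
  𝟙 b = if b then 1 else 0

  size : ∀ {n} → (Fin n → Bool) → ℕ
  size U = sum (𝟙 ∘ U)

  odd : ℕ → Bool
  odd zero    = false
  odd (suc n) = not (odd n)

  bit : ℕ → ℕ → Bool
  bit zero    n = odd n
  bit (suc k) n = bit k ⌊ n /2⌋

  odd+2*half : ∀ n → 𝟙 (odd n) + 2 * ⌊ n /2⌋ ≡ n
  odd+2*half zero          = refl
  odd+2*half (suc zero)    = refl
  odd+2*half (suc (suc n)) = begin-equality
    𝟙 (not (not (odd n))) + 2 * suc ⌊ n /2⌋  ≡⟨ cong (_+ 2 * suc ⌊ n /2⌋) (not-not (odd n)) ⟩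
    𝟙 (odd n) + 2 * suc ⌊ n /2⌋              ≡⟨ solve 2 (λ b h → b :+ con 2 :* (con 1 :+ h) := con 2 :+ (b :+ con 2 :* h)) refl (𝟙 (odd n)) ⌊ n /2⌋ ⟩
    2 + (𝟙 (odd n) + 2 * ⌊ n /2⌋)            ≡⟨ cong (2 +_) (odd+2*half n) ⟩
    2 + n                                    ∎
    where
    not-not : ∀ b → 𝟙 (not (not b)) ≡ 𝟙 b
    not-not true  = refl
    not-not false = refl

  half<2^ : ∀ {n} T → n < 2 ^ suc T → ⌊ n /2⌋ < 2 ^ T
  half<2^ {n} T n<2^1+T = *-cancelˡ-< 2 _ _ (begin-strict
    2 * ⌊ n /2⌋                 ≤⟨ m≤n+m (2 * ⌊ n /2⌋) (𝟙 (odd n)) ⟩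
    𝟙 (odd n) + 2 * ⌊ n /2⌋     ≡⟨ odd+2*half n ⟩
    n                           <⟨ n<2^1+T ⟩
    2 * 2 ^ T                   ∎)

  n<2^n : ∀ n → n < 2 ^ n
  n<2^n zero    = s≤s z≤n
  n<2^n (suc n) = begin-strict
    1 + n            <⟨ +-mono-≤-< (m^n>0 2 n) (n<2^n n) ⟩
    2 ^ n + 2 ^ n    ≡⟨ cong (2 ^ n +_) (+-identityʳ _) ⟨
    2 * 2 ^ n        ∎

  binary-expansion : ∀ T n → n < 2 ^ T → sum {T} (λ k → 2 ^ toℕ k * 𝟙 (bit (toℕ k) n)) ≡ n
  binary-expansion zero    zero n<1 = refl
  binary-expansion zero    (suc n) (s≤s ())
  binary-expansion (suc T) n n<2^1+T = begin-equality
    1 * 𝟙 (odd n) + sum {T} (λ k → 2 * 2 ^ toℕ k * 𝟙 (bit (toℕ k) ⌊ n /2⌋))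
      ≡⟨ cong₂ _+_ (*-identityˡ _) (sum-cong-≗ {T} λ k → *-assoc 2 (2 ^ toℕ k) _) ⟩
    𝟙 (odd n) + sum {T} (λ k → 2 * (2 ^ toℕ k * 𝟙 (bit (toℕ k) ⌊ n /2⌋)))
      ≡⟨ cong (𝟙 (odd n) +_) (*-distribˡ-sum {T} 2 _) ⟨
    𝟙 (odd n) + 2 * sum {T} (λ k → 2 ^ toℕ k * 𝟙 (bit (toℕ k) ⌊ n /2⌋))
      ≡⟨ cong (λ h → 𝟙 (odd n) + 2 * h) (binary-expansion T ⌊ n /2⌋ (half<2^ T n<2^1+T)) ⟩
    𝟙 (odd n) + 2 * ⌊ n /2⌋
      ≡⟨ odd+2*half n ⟩
    n ∎

  𝟙*𝟙 : ∀ b → 𝟙 b * 𝟙 b ≡ 𝟙 b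
  𝟙*𝟙 true  = refl
  𝟙*𝟙 false = refl

  -- Squaring the binary expansion and dropping the cross terms leaves the left side. In the
  -- recursion n = b + 2h, the dropped term is 4bh.
  ∑-4^k-bits≤square : ∀ T n → sum {T} (λ k → 4 ^ toℕ k * 𝟙 (bit (toℕ k) n)) ≤ n * n
  ∑-4^k-bits≤square zero    n = z≤n
  ∑-4^k-bits≤square (suc T) n = begin
    1 * 𝟙 (odd n) + sum {T} (λ k → 4 * 4 ^ toℕ k * 𝟙 (bit (toℕ k) ⌊ n /2⌋))
      ≡⟨ cong₂ _+_ (*-identityˡ _) (sum-cong-≗ {T} λ k → *-assoc 4 (4 ^ toℕ k) _) ⟩
    b + sum {T} (λ k → 4 * (4 ^ toℕ k * 𝟙 (bit (toℕ k) h)))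
      ≡⟨ cong (b +_) (*-distribˡ-sum {T} 4 _) ⟨
    b + 4 * sum {T} (λ k → 4 ^ toℕ k * 𝟙 (bit (toℕ k) h))
      ≤⟨ +-monoʳ-≤ b (*-monoʳ-≤ 4 (∑-4^k-bits≤square T h)) ⟩
    b + 4 * (h * h)
      ≡⟨ cong (_+ 4 * (h * h)) (𝟙*𝟙 (odd n)) ⟨
    b * b + 4 * (h * h)
      ≤⟨ m≤m+n _ _ ⟩
    b * b + 4 * (h * h) + 4 * (b * h)
      ≡⟨ solve 2 (λ b h → b :* b :+ con 4 :* (h :* h) :+ con 4 :* (b :* h)
                       := (b :+ con 2 :* h) :* (b :+ con 2 :* h)) refl b h ⟩
    (b + 2 * h) * (b + 2 * h)
      ≡⟨ cong₂ _*_ (odd+2*half n) (odd+2*half n) ⟩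
    n * n ∎
    where
    b h : ℕ
    b = 𝟙 (odd n)
    h = ⌊ n /2⌋

  -- weight k l is 2^(L+k+l) if l + L ≤ k, it is 4^k if |k − l| < L, and it is 0 otherwise; the shift
  -- invariance of these cases makes the recursion.
  module _ (L : ℕ) where

    weight : ℕ → ℕ → ℕ
    weight k       zero    = if k <ᵇ L then 4 ^ k else 2 ^ (L + k)
    weight zero    (suc l) = 𝟙 (suc l <ᵇ L)
    weight (suc k) (suc l) = 4 * weight k l

    4^≡2^*2^ : ∀ k → 4 ^ k ≡ 2 ^ (k + k)
    4^≡2^*2^ k = trans (^-*-assoc 2 2 k) (cong (2 ^_) (cong (k +_) (+-identityʳ k)))

    -- The two branches agree at `k ≡ L`, where 2^(L + L) = 4^L; this gives the boundary case.
    weight-zero : ∀ k → k ≤ L → weight k 0 ≡ 4 ^ k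
    weight-zero k k≤L with k <ᵇ L | <ᵇ-reflects-< k L
    ... | true  | _        = refl
    ... | false | ofⁿ k≮L = sym (trans (4^≡2^*2^ k) (cong (λ m → 2 ^ (m + k)) (≤-antisym k≤L (≮⇒≥ k≮L))))

    private
      row : ℕ → ℕ → ℕ
      row T k = sum {T} (λ l → weight k (toℕ l))

      count-< : ∀ m T → sum {T} (λ l → 𝟙 (toℕ l <ᵇ m)) ≤ m
      count-< m       zero    = z≤n
      count-< zero    (suc T) = count-< zero T
      count-< (suc m) (suc T) = s≤s (count-< m T)

      row-suc : ∀ T k → row (suc T) (suc k) ≡ weight (suc k) 0 + 4 * row T k
      row-suc T k = cong (weight (suc k) 0 +_) (sym (*-distribˡ-sum {T} 4 _))

      -- For `k ≤ L` every nonzero weight in the row is 4^k: there are at most k + 1 of them with l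
      -- ≤ k, and at most L with l > k.
      row-≤ : ∀ T k → k ≤ L → row T k ≤ 4 ^ k * (L + 1 + k)
      row-≤ zero    k       k≤L = z≤n
      row-≤ (suc T) zero    _   = begin
        weight 0 0 + sum {T} (λ l → 𝟙 (suc (toℕ l) <ᵇ L))
          ≤⟨ +-mono-≤ (≤-reflexive (weight-zero 0 z≤n)) (shifted L) ⟩
        1 + L
          ≡⟨ solve 1 (λ L → con 1 :+ L := con 1 :* (L :+ con 1 :+ con 0)) refl L ⟩
        4 ^ 0 * (L + 1 + 0) ∎
        where
        shifted : ∀ m → sum {T} (λ l → 𝟙 (suc (toℕ l) <ᵇ m)) ≤ m
        shifted m = ≤-trans (m≤n+m _ _) (count-< m (suc T))
      row-≤ (suc T) (suc k) 1+k≤L = begin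
        row (suc T) (suc k)                      ≡⟨ row-suc T k ⟩
        weight (suc k) 0 + 4 * row T k           ≤⟨ +-mono-≤ (≤-reflexive (weight-zero (suc k) 1+k≤L))
                                                      (*-monoʳ-≤ 4 (row-≤ T k (<⇒≤ 1+k≤L))) ⟩
        4 * 4 ^ k + 4 * (4 ^ k * (L + 1 + k))    ≡⟨ solve 3 (λ p L k → con 4 :* p :+ con 4 :* (p :* (L :+ con 1 :+ k))
                                                      := con 4 :* p :* (L :+ con 1 :+ (con 1 :+ k))) refl (4 ^ k) L k ⟩
        4 ^ suc k * (L + 1 + suc k)              ∎

      -- The extra summand 2^(L + k) makes the geometric series close up. Passing from k to k + 1,
      -- the new entry at l = 0 and the new extra summand are each twice the old summand, together
      -- four times it, so the whole left side grows by a factor 4. At k = L the extra summand is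
      -- 4^L, which turns the coefficient 2L + 1 of `row-≤` into 2L + 2.
      row-+≤ : ∀ T j → row T (j + L) + 2 ^ (L + (j + L)) ≤ 4 ^ (j + L) * (2 * L + 2)
      row-+≤ T zero = begin
        row T L + 2 ^ (L + L)               ≤⟨ +-mono-≤ (row-≤ T L ≤-refl) (≤-reflexive (sym (4^≡2^*2^ L))) ⟩
        4 ^ L * (L + 1 + L) + 4 ^ L         ≡⟨ solve 2 (λ p L → p :* (L :+ con 1 :+ L) :+ p
                                                 := p :* (con 2 :* L :+ con 2)) refl (4 ^ L) L ⟩
        4 ^ L * (2 * L + 2)                 ∎
      row-+≤ zero (suc j) = begin
        2 ^ (L + suc (j + L))               ≡⟨ cong (2 ^_) (+-suc L (j + L)) ⟩
        2 * 2 ^ (L + (j + L))               ≤⟨ *-mono-≤ {2} {4} (s≤s (s≤s z≤n)) (row-+≤ zero j) ⟩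
        4 * (4 ^ (j + L) * (2 * L + 2))     ≡⟨ *-assoc 4 (4 ^ (j + L)) _ ⟨
        4 ^ (suc j + L) * (2 * L + 2)       ∎
      row-+≤ (suc T) (suc j) = begin
        row (suc T) (suc k) + 2 ^ (L + suc k)
          ≡⟨ cong₂ _+_ (row-suc T k) 2^[L+1+k] ⟩
        weight (suc k) 0 + 4 * row T k + 2 * 2 ^ (L + k)
          ≡⟨ cong (λ w → w + 4 * row T k + 2 * 2 ^ (L + k)) weight≡ ⟩
        2 * 2 ^ (L + k) + 4 * row T k + 2 * 2 ^ (L + k)
          ≡⟨ solve 2 (λ p r → con 2 :* p :+ con 4 :* r :+ con 2 :* p := con 4 :* (r :+ p)) refl (2 ^ (L + k)) (row T k) ⟩
        4 * (row T k + 2 ^ (L + k))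
          ≤⟨ *-monoʳ-≤ 4 (row-+≤ T j) ⟩
        4 * (4 ^ k * (2 * L + 2))
          ≡⟨ *-assoc 4 (4 ^ k) _ ⟨
        4 ^ suc k * (2 * L + 2) ∎
        where
        k : ℕ
        k = j + L
        2^[L+1+k] : 2 ^ (L + suc k) ≡ 2 * 2 ^ (L + k)
        2^[L+1+k] = cong (2 ^_) (+-suc L k)
        weight≡ : weight (suc k) 0 ≡ 2 * 2 ^ (L + k)
        weight≡ with suc k <ᵇ L | <ᵇ-reflects-< (suc k) L
        ... | true  | ofʸ 1+k<L = contradiction 1+k<L (≤⇒≯ (≤-trans (m≤n+m L j) (n≤1+n k)))
        ... | false | _         = 2^[L+1+k]

    ∑-weight≤ : ∀ T k → sum {T} (λ l → weight k (toℕ l)) ≤ 4 ^ k * (2 * L + 2)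
    ∑-weight≤ T k with k ≤? L
    ... | yes k≤L = ≤-trans (row-≤ T k k≤L) (*-monoʳ-≤ (4 ^ k) (begin
      L + 1 + k        ≤⟨ +-monoʳ-≤ (L + 1) k≤L ⟩
      L + 1 + L        ≤⟨ m≤m+n _ 1 ⟩
      L + 1 + L + 1    ≡⟨ solve 1 (λ L → L :+ con 1 :+ L :+ con 1 := con 2 :* L :+ con 2) refl L ⟩
      2 * L + 2        ∎))
    ... | no  k≰L = ≡.subst (λ k → row T k ≤ 4 ^ k * (2 * L + 2)) (m∸n+n≡m (<⇒≤ (≰⇒> k≰L)))
      (≤-trans (m≤m+n _ _) (row-+≤ T (k ∸ L)))

    -- The bound is uniform in the number `T` of digits: each row sum is charged to 4^k times the
    -- size of the digit set, and these charges add up to at most |f|².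
    ∑-weight-digits≤ : ∀ {n} T (f : Fin n → ℕ) →
      sum {T} (λ k → sum {T} (λ l → weight (toℕ k) (toℕ l) * size (bit (toℕ k) ∘ f))) ≤
      (2 * L + 2) * sum (λ u → f u * f u)
    ∑-weight-digits≤ {n} T f = begin
      sum {T} (λ k → sum {T} (λ l → weight (toℕ k) (toℕ l) * size (digit k)))
        ≡⟨ sum-cong-≗ {T} (λ k → *-distribʳ-sum {T} (size (digit k)) _) ⟨
      sum {T} (λ k → sum {T} (λ l → weight (toℕ k) (toℕ l)) * size (digit k))
        ≤⟨ sum-mono-≤ {T} (λ k → *-monoˡ-≤ (size (digit k)) (∑-weight≤ T (toℕ k))) ⟩
      sum {T} (λ k → 4 ^ toℕ k * (2 * L + 2) * size (digit k))
        ≡⟨ sum-cong-≗ {T} (λ k → solve 3 (λ p c s → p :* c :* s := c :* (p :* s)) refl (4 ^ toℕ k) (2 * L + 2) (size (digit k))) ⟩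
      sum {T} (λ k → (2 * L + 2) * (4 ^ toℕ k * size (digit k)))
        ≡⟨ *-distribˡ-sum {T} (2 * L + 2) _ ⟨
      (2 * L + 2) * sum {T} (λ k → 4 ^ toℕ k * size (digit k))
        ≡⟨ cong ((2 * L + 2) *_) (sum-cong-≗ {T} (λ k → *-distribˡ-sum (4 ^ toℕ k) (𝟙 ∘ digit k))) ⟩
      (2 * L + 2) * sum {T} (λ k → sum (λ u → 4 ^ toℕ k * 𝟙 (digit k u)))
        ≡⟨ cong ((2 * L + 2) *_) (∑-comm {T} (λ k u → 4 ^ toℕ k * 𝟙 (digit k u))) ⟩
      (2 * L + 2) * sum (λ u → sum {T} (λ k → 4 ^ toℕ k * 𝟙 (digit k u)))
        ≤⟨ *-monoʳ-≤ (2 * L + 2) (sum-mono-≤ (λ u → ∑-4^k-bits≤square T (f u))) ⟩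
      (2 * L + 2) * sum (λ u → f u * f u) ∎
      where
      digit : Fin T → Fin n → Bool
      digit k u = bit (toℕ k) (f u)

open Dyadic using (𝟙; size; bit; weight; weight-zero; 4^≡2^*2^; ∑-weight-digits≤; binary-expansion; n<2^n; ≤-sum; sum-mono-≤)

-- From indicator vectors to real vectors

module BilinearForms {c ℓ₁ ℓ₂} (ℝ : RealNumbers c ℓ₁ ℓ₂) where
  open RealNumbers ℝ hiding (zero)
  open OrderedFieldProperties ℝ
  open ≤-Reasoning

  fromℕ-∑ : ∀ {n} (f : Fin n → ℕ) → fromℕ (ℕ-Sum.sum f) ≈ ∑ (fromℕ ∘ f)
  fromℕ-∑ {zero}  f = refl
  fromℕ-∑ {suc n} f = trans (fromℕ-+ (f zero) _) (+-congˡ (fromℕ-∑ (f ∘ suc)))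

  normSq : ∀ {n} → (Fin n → Carrier) → Carrier
  normSq f = ∑ (λ u → f u * f u)

  normSq-nonneg : ∀ {n} (f : Fin n → Carrier) → 0# ≤ normSq f
  normSq-nonneg f = ∑-nonneg λ u → x*x-nonneg (f u)

  form : ∀ {m n} → (Fin m → Fin n → Carrier) → (Fin m → Carrier) → (Fin n → Carrier) → Carrier
  form E f g = ∑ λ u → ∑ λ v → E u v * (f u * g v)

  form-cong : ∀ {m n} (E : Fin m → Fin n → Carrier) {f f′ g g′} →
    (∀ u → f u ≈ f′ u) → (∀ v → g v ≈ g′ v) → form E f g ≈ form E f′ g′
  form-cong E f≈f′ g≈g′ = ∑∑-cong λ u v → *-congˡ (*-cong (f≈f′ u) (g≈g′ v))

  form-* : ∀ {m n} (E : Fin m → Fin n → Carrier) a b f g →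
    form E (λ u → a * f u) (λ v → b * g v) ≈ a * b * form E f g
  form-* E a b f g = trans
    (∑∑-cong λ u v → solve 5 (λ e a b f g → e :* ((a :* f) :* (b :* g)) := a :* b :* (e :* (f :* g)))
                       refl (E u v) a b (f u) (g v))
    (sym (*-distribˡ-∑∑ (a * b) λ u v → E u v * (f u * g v)))

  form-neg : ∀ {m n} (E : Fin m → Fin n → Carrier) f g →
    form (λ u v → - E u v) f g ≈ - form E f g
  form-neg E f g = trans
    (∑∑-cong λ u v → solve 3 (λ e f g → (:- e) :* (f :* g) := con -1ℤ :* (e :* (f :* g)))
                       refl (E u v) (f u) (g v))
    (trans (sym (*-distribˡ-∑∑ (- 1#) λ u v → E u v * (f u * g v)))
           (solve 1 (λ q → con -1ℤ :* q := :- q) refl (form E f g)))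

  form-∑ : ∀ {m n T} (E : Fin m → Fin n → Carrier) (f : Fin m → Fin T → Carrier) (g : Fin n → Fin T → Carrier) →
    form E (λ u → ∑ (f u)) (λ v → ∑ (g v)) ≈
    ∑ (λ k → ∑ (λ l → form E (λ u → f u k) (λ v → g v l)))
  form-∑ {m} {n} {T} E f g = begin-equality
    ∑ (λ u → ∑ λ v → E u v * (∑ (f u) * ∑ (g v)))
      ≈⟨ ∑∑-cong (λ u v → trans (*-congˡ (∑-*-∑ (f u) (g v))) (*-distribˡ-∑∑ (E u v) λ k l → f u k * g v l)) ⟩
    ∑ (λ u → ∑ λ v → ∑ λ k → ∑ λ l → t u v k l)
      ≈⟨ ∑-cong (λ u → trans (∑-comm λ v k → ∑ (t u v k)) (∑-cong λ k → ∑-comm λ v l → t u v k l)) ⟩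
    ∑ (λ u → ∑ λ k → ∑ λ l → ∑ λ v → t u v k l)
      ≈⟨ trans (∑-comm λ u k → ∑ λ l → ∑ λ v → t u v k l) (∑-cong λ k → ∑-comm λ u l → ∑ λ v → t u v k l) ⟩
    ∑ (λ k → ∑ λ l → ∑ λ u → ∑ λ v → t u v k l) ∎
    where
    t : Fin m → Fin n → Fin T → Fin T → Carrier
    t u v k l = E u v * (f u k * g v l)

  module _ (ε : Carrier) (0≤ε : 0# ≤ ε) where

    private
      -- A record, so that the numbers can be inferred from a bound.
      record _·_≼_ (a : ℕ) (q : Carrier) (b : ℕ) : Set ℓ₂ where
        constructor ⟨_⟩
        field bound : fromℕ a * q ≤ ε * fromℕ b

      scale : ∀ {q a b} c → a · q ≼ b → (c ℕ.* a) · q ≼ (c ℕ.* b)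
      scale {q} {a} {b} c ⟨ aq≤b ⟩ = ⟨ begin
        fromℕ (c ℕ.* a) * q       ≈⟨ *-congʳ (fromℕ-* c a) ⟩
        fromℕ c * fromℕ a * q     ≈⟨ *-assoc _ _ _ ⟩
        fromℕ c * (fromℕ a * q)   ≤⟨ *-monoˡ-≤ (fromℕ-nonneg c) aq≤b ⟩
        fromℕ c * (ε * fromℕ b)   ≈⟨ solve 3 (λ c e b → c :* (e :* b) := e :* (c :* b)) refl (fromℕ c) ε (fromℕ b) ⟩
        ε * (fromℕ c * fromℕ b)   ≈⟨ *-congˡ (fromℕ-* c b) ⟨
        ε * fromℕ (c ℕ.* b)       ∎ ⟩

      recast : ∀ {q a a′ b b′} → a ≡ a′ → b ≡ b′ → a · q ≼ b → a′ · q ≼ b′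
      recast ≡.refl ≡.refl aq≼b = aq≼b

      open ℕ-Solver using () renaming (solve to solveℕ; _:=_ to _⊜_; _:+_ to _⊕_; _:*_ to _⊗_; con to #)

    -- q is the form of a pair of sets of sizes u and v.
    record Discrepancy (L : ℕ) (q : Carrier) (u v : ℕ) : Set ℓ₂ where
      field
        -- The square root is already gone, by xy√(uv) ≤ x²u + y²v, and the factors `x` and `y`
        -- leave room for the place values of the digits. In the one-sided bounds, 2^L times ϵ
        -- stands for the trivial constant K.
        mixed : ∀ x y → fromℕ (x ℕ.* y) * q ≤ ε * fromℕ (x ℕ.* x ℕ.* u ℕ.+ y ℕ.* y ℕ.* v)
        left  : q ≤ ε * fromℕ (2 ℕ.^ L ℕ.* u)
        right : q ≤ ε * fromℕ (2 ℕ.^ L ℕ.* v)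

    private
      swap : ∀ {L q u v} → Discrepancy L q u v → Discrepancy L q v u
      swap {u = u} D = record
        { mixed = λ x y → _·_≼_.bound (recast (ℕ.*-comm y x) (ℕ.+-comm (y ℕ.* y ℕ.* u) _) ⟨ mixed y x ⟩)
        ; left  = right
        ; right = left
        }
        where open Discrepancy D

      -- Close digits, `l < L`, use `mixed` with factors 1 and 2^l. For distant ones `right` charges
      -- everything to the set with the larger place value, since 2^l times 2^L is the weight of the
      -- pair (l, 0).
      weighted-base : ∀ {L q u v} → Discrepancy L q u v → ∀ l →
        (2 ℕ.^ l) · q ≼ (weight L 0 l ℕ.* u ℕ.+ weight L l 0 ℕ.* v)
      weighted-base {L} {q} {u} {v} D zero = recast ≡.refl
        (≡.cong (λ w → w ℕ.* u ℕ.+ w ℕ.* v) (≡.sym (weight-zero L 0 z≤n)))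
        ⟨ Discrepancy.mixed D 1 1 ⟩
      weighted-base {L} {q} {u} {v} D (suc l) with suc l ℕ.<ᵇ L
      ... | true  = recast (ℕ.+-identityʳ _)
        (≡.cong (λ w → 1 ℕ.* u ℕ.+ w ℕ.* v)
          (≡.trans (≡.sym (ℕ.^-distribˡ-+-* 2 (suc l) (suc l))) (≡.sym (4^≡2^*2^ L (suc l)))))
        ⟨ Discrepancy.mixed D 1 (2 ℕ.^ suc l) ⟩
      ... | false = recast (ℕ.*-identityʳ _)
        (≡.trans (solveℕ 3 (λ a b v → a ⊗ (b ⊗ v) ⊜ # 0 ⊕ (b ⊗ a) ⊗ v) ≡.refl (2 ℕ.^ suc l) (2 ℕ.^ L) v)
                 (≡.cong (ℕ._* v) (≡.sym (ℕ.^-distribˡ-+-* 2 L (suc l)))))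
        (scale {a = 1} (2 ℕ.^ suc l)
          ⟨ ≤-trans (≤-reflexive (trans (*-congʳ fromℕ-1) (*-identityˡ q))) (Discrepancy.right D) ⟩)

      -- Raising both digits by one multiplies each side by 4, so all pairs reduce to those with a
      -- zero digit; exchanging the two sets handles a zero second digit.
      weighted : ∀ {L q u v} → Discrepancy L q u v → ∀ k l →
        (2 ℕ.^ k ℕ.* 2 ℕ.^ l) · q ≼ (weight L k l ℕ.* u ℕ.+ weight L l k ℕ.* v)
      weighted D zero    l       = recast (≡.sym (ℕ.*-identityˡ _)) ≡.refl (weighted-base D l)
      weighted {L} {u = u} {v} D (suc k) zero =
        recast (≡.sym (ℕ.*-identityʳ _)) (ℕ.+-comm (weight L 0 (suc k) ℕ.* v) (weight L (suc k) 0 ℕ.* u))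
          (weighted-base (swap D) (suc k))
      weighted {L} {q} {u} {v} D (suc k) (suc l) = recast
        (solveℕ 2 (λ a b → # 4 ⊗ (a ⊗ b) ⊜ (# 2 ⊗ a) ⊗ (# 2 ⊗ b)) ≡.refl (2 ℕ.^ k) (2 ℕ.^ l))
        (solveℕ 4 (λ a b u v → # 4 ⊗ (a ⊗ u ⊕ b ⊗ v) ⊜ (# 4 ⊗ a) ⊗ u ⊕ (# 4 ⊗ b) ⊗ v) ≡.refl (weight L k l) (weight L l k) u v)
        (scale 4 (weighted D k l))

    module _ {n} (L : ℕ) (E : Fin n → Fin n → Carrier)
      (discrepancy : ∀ U V → Discrepancy L (form E (fromℕ ∘ 𝟙 ∘ U) (fromℕ ∘ 𝟙 ∘ V)) (size U) (size V)) where

      private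
        κ : Carrier
        κ = ε * fromℕ (2 ℕ.* L ℕ.+ 2)

        0≤κ : 0# ≤ κ
        0≤κ = *-nonneg 0≤ε (fromℕ-nonneg (2 ℕ.* L ℕ.+ 2))

      form-ℕ≤ : ∀ (f g : Fin n → ℕ) →
        form E (fromℕ ∘ f) (fromℕ ∘ g) ≤ κ * (normSq (fromℕ ∘ f) + normSq (fromℕ ∘ g))
      form-ℕ≤ f g = begin
        form E (fromℕ ∘ f) (fromℕ ∘ g)
          ≈⟨ form-cong E (λ u → digits f u (<2^T u (ℕ.m≤m+n _ _))) (λ v → digits g v (<2^T′ v (ℕ.m≤n+m _ _))) ⟩
        form E (λ u → ∑ λ k → fromℕ (2 ℕ.^ toℕ k) * 𝟙ᶠ k u) (λ v → ∑ λ l → fromℕ (2 ℕ.^ toℕ l) * 𝟙ᵍ l v)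
          ≈⟨ form-∑ {T = T} E (λ u k → fromℕ (2 ℕ.^ toℕ k) * 𝟙ᶠ k u) (λ v l → fromℕ (2 ℕ.^ toℕ l) * 𝟙ᵍ l v) ⟩
        ∑ (λ k → ∑ λ l → form E (λ u → fromℕ (2 ℕ.^ toℕ k) * 𝟙ᶠ k u) (λ v → fromℕ (2 ℕ.^ toℕ l) * 𝟙ᵍ l v))
          ≈⟨ ∑∑-cong (λ k l → trans (form-* E (fromℕ (2 ℕ.^ toℕ k)) (fromℕ (2 ℕ.^ toℕ l)) (𝟙ᶠ k) (𝟙ᵍ l))
                                    (*-congʳ (sym (fromℕ-* (2 ℕ.^ toℕ k) (2 ℕ.^ toℕ l))))) ⟩
        ∑ (λ k → ∑ λ l → fromℕ (2 ℕ.^ toℕ k ℕ.* 2 ℕ.^ toℕ l) * form E (𝟙ᶠ k) (𝟙ᵍ l))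
          ≤⟨ ∑∑-mono-≤ {T} {T} (λ k l → _·_≼_.bound (weighted (discrepancy (bit (toℕ k) ∘ f) (bit (toℕ l) ∘ g)) (toℕ k) (toℕ l))) ⟩
        ∑ (λ k → ∑ λ l → ε * fromℕ (A k l ℕ.+ B l k))
          ≈⟨ *-distribˡ-∑∑ ε (λ k l → fromℕ (A k l ℕ.+ B l k)) ⟨
        ε * ∑ (λ k → ∑ λ l → fromℕ (A k l ℕ.+ B l k))
          ≈⟨ *-congˡ (trans (fromℕ-∑ {T} (λ k → ℕ-Sum.sum λ l → A k l ℕ.+ B l k)) (∑-cong λ k → fromℕ-∑ λ l → A k l ℕ.+ B l k)) ⟨
        ε * fromℕ (ℕ-Sum.sum (λ k → ℕ-Sum.sum λ l → A k l ℕ.+ B l k))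
          ≤⟨ *-monoˡ-≤ 0≤ε (fromℕ-mono-≤ total) ⟩
        ε * fromℕ ((2 ℕ.* L ℕ.+ 2) ℕ.* (ℕ-Sum.sum (λ u → f u ℕ.* f u) ℕ.+ ℕ-Sum.sum (λ v → g v ℕ.* g v)))
          ≈⟨ *-congˡ (trans (fromℕ-* (2 ℕ.* L ℕ.+ 2) _) (*-congˡ (trans (fromℕ-+ (ℕ-Sum.sum (λ u → f u ℕ.* f u)) _)
               (+-cong (normSq-ℕ f) (normSq-ℕ g))))) ⟩
        ε * (fromℕ (2 ℕ.* L ℕ.+ 2) * (normSq (fromℕ ∘ f) + normSq (fromℕ ∘ g)))
          ≈⟨ *-assoc _ _ _ ⟨
        κ * (normSq (fromℕ ∘ f) + normSq (fromℕ ∘ g)) ∎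
        where
        -- Enough digits for every entry at once, as each entry is at most `T` and `T` is below 2^T.
        -- The crude choice is harmless because the estimate is uniform in `T`.
        T : ℕ
        T = ℕ-Sum.sum f ℕ.+ ℕ-Sum.sum g
        <2^T : ∀ u → ℕ-Sum.sum f ℕ.≤ T → f u ℕ.< 2 ℕ.^ T
        <2^T u s≤T = ℕ.≤-<-trans (ℕ.≤-trans (≤-sum f u) s≤T) (n<2^n T)
        <2^T′ : ∀ v → ℕ-Sum.sum g ℕ.≤ T → g v ℕ.< 2 ℕ.^ T
        <2^T′ v s≤T = ℕ.≤-<-trans (ℕ.≤-trans (≤-sum g v) s≤T) (n<2^n T)
        𝟙ᶠ 𝟙ᵍ : Fin T → Fin n → Carrier
        𝟙ᶠ k u = fromℕ (𝟙 (bit (toℕ k) (f u)))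
        𝟙ᵍ l v = fromℕ (𝟙 (bit (toℕ l) (g v)))
        A B : Fin T → Fin T → ℕ
        A k l = weight L (toℕ k) (toℕ l) ℕ.* size (bit (toℕ k) ∘ f)
        B l k = weight L (toℕ l) (toℕ k) ℕ.* size (bit (toℕ l) ∘ g)
        digits : ∀ (h : Fin n → ℕ) u → h u ℕ.< 2 ℕ.^ T →
          fromℕ (h u) ≈ ∑ {T} λ k → fromℕ (2 ℕ.^ toℕ k) * fromℕ (𝟙 (bit (toℕ k) (h u)))
        digits h u hu<2^T = begin-equality
          fromℕ (h u)
            ≡⟨ ≡.cong fromℕ (binary-expansion T (h u) hu<2^T) ⟨
          fromℕ (ℕ-Sum.sum {T} λ k → 2 ℕ.^ toℕ k ℕ.* 𝟙 (bit (toℕ k) (h u)))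
            ≈⟨ fromℕ-∑ {T} _ ⟩
          ∑ {T} (λ k → fromℕ (2 ℕ.^ toℕ k ℕ.* 𝟙 (bit (toℕ k) (h u))))
            ≈⟨ ∑-cong {T} (λ k → fromℕ-* (2 ℕ.^ toℕ k) _) ⟩
          ∑ {T} (λ k → fromℕ (2 ℕ.^ toℕ k) * fromℕ (𝟙 (bit (toℕ k) (h u)))) ∎
        normSq-ℕ : ∀ (h : Fin n → ℕ) → fromℕ (ℕ-Sum.sum λ u → h u ℕ.* h u) ≈ normSq (fromℕ ∘ h)
        normSq-ℕ h = trans (fromℕ-∑ (λ u → h u ℕ.* h u)) (∑-cong λ u → fromℕ-* (h u) (h u))
        total : ℕ-Sum.sum (λ k → ℕ-Sum.sum λ l → A k l ℕ.+ B l k) ℕ.≤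
                (2 ℕ.* L ℕ.+ 2) ℕ.* (ℕ-Sum.sum (λ u → f u ℕ.* f u) ℕ.+ ℕ-Sum.sum (λ v → g v ℕ.* g v))
        total = ℕ.≤-trans
          (ℕ.≤-reflexive (≡.trans
            (ℕ-Sum.sum-cong-≗ {T} λ k → ℕ-Sum.∑-distrib-+ (A k) λ l → B l k)
            (≡.trans (ℕ-Sum.∑-distrib-+ (λ k → ℕ-Sum.sum (A k)) λ k → ℕ-Sum.sum λ l → B l k)
              (≡.cong (ℕ-Sum.sum (λ k → ℕ-Sum.sum (A k)) ℕ.+_) (ℕ-Sum.∑-comm {T} λ k l → B l k)))))
          (ℕ.≤-trans (ℕ.+-mono-≤ (∑-weight-digits≤ L T f) (∑-weight-digits≤ L T g))
            (ℕ.≤-reflexive (≡.sym (ℕ.*-distribˡ-+ (2 ℕ.* L ℕ.+ 2) _ _))))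

      -- Scaling both vectors by `m` multiplies the form and the norms by m², while rounding down to
      -- naturals costs the form only m times `slack` and does not increase the norms. After one
      -- factor `m` is cancelled, the excess times `m` is bounded for all `m`.
      form-nonneg≤ : ∀ (f g : Fin n → Carrier) → (∀ u → 0# ≤ f u) → (∀ v → 0# ≤ g v) →
        form E f g ≤ κ * (normSq f + normSq g)
      form-nonneg≤ f g 0≤f 0≤g = 0≤y-x⇒x≤y (≤-trans (x≤0⇒0≤-x (multiples-bounded⇒≤0 multiple≤))
        (≤-reflexive (solve 2 (λ x y → :- (x :- y) := y :- x) refl (form E f g) (κ * (normSq f + normSq g)))))
        where
        slack : Carrier
        -- Rounding F and G down by at most 2 lowers their product by at most 2(F + G), which is
        -- linear in the scale. The absolute value is there because entries of `E` have either sign.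
        slack = ∑ λ u → ∑ λ v → ∣ E u v ∣ * (fromℕ 2 * (f u + g v))

        0≤slack : 0# ≤ slack
        0≤slack = ∑-nonneg λ u → ∑-nonneg λ v → *-nonneg (∣x∣-nonneg (E u v))
          (*-nonneg (fromℕ-nonneg 2) (+-nonneg (0≤f u) (0≤g v)))

        module _ (m : ℕ) where
          F G : Fin n → Carrier
          F u = fromℕ m * f u
          G v = fromℕ m * g v

          0≤F : ∀ u → 0# ≤ F u
          0≤F u = *-nonneg (fromℕ-nonneg m) (0≤f u)
          0≤G : ∀ v → 0# ≤ G v
          0≤G v = *-nonneg (fromℕ-nonneg m) (0≤g v)

          a b : Fin n → ℕ
          a u = proj₁ (floor (F u) (0≤F u))
          b v = proj₁ (floor (G v) (0≤G v))

          a≤F : ∀ u → fromℕ (a u) ≤ F u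
          a≤F u = proj₁ (proj₂ (floor (F u) (0≤F u)))
          F≤a+2 : ∀ u → F u ≤ fromℕ (a u) + fromℕ 2
          F≤a+2 u = proj₂ (proj₂ (floor (F u) (0≤F u)))
          b≤G : ∀ v → fromℕ (b v) ≤ G v
          b≤G v = proj₁ (proj₂ (floor (G v) (0≤G v)))
          G≤b+2 : ∀ v → G v ≤ fromℕ (b v) + fromℕ 2
          G≤b+2 v = proj₂ (proj₂ (floor (G v) (0≤G v)))

          rounding : ∀ u v → 0# ≤ F u * G v - fromℕ (a u) * fromℕ (b v) ×
                             F u * G v - fromℕ (a u) * fromℕ (b v) ≤ fromℕ 2 * (F u + G v)
          rounding u v =
            x≤y⇒0≤y-x (*-mono-≤ (0≤F u) (fromℕ-nonneg (b v)) (a≤F u) (b≤G v)) ,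
            (begin
              F u * G v - a′ * b′
                ≈⟨ solve 4 (λ F G a b → F :* G :- a :* b := a :* (G :- b) :+ (F :- a) :* G) refl (F u) (G v) a′ b′ ⟩
              a′ * (G v - b′) + (F u - a′) * G v
                ≤⟨ +-mono-≤ (*-mono-≤ (0≤F u) (x≤y⇒0≤y-x (b≤G v)) (a≤F u) (error≤2 (G≤b+2 v)))
                            (*-monoʳ-≤ (0≤G v) (error≤2 (F≤a+2 u))) ⟩
              F u * fromℕ 2 + fromℕ 2 * G v
                ≈⟨ solve 3 (λ F G t → F :* t :+ t :* G := t :* (F :+ G)) refl (F u) (G v) (fromℕ 2) ⟩
              fromℕ 2 * (F u + G v) ∎)
            where
            a′ b′ : Carrier
            a′ = fromℕ (a u)
            b′ = fromℕ (b v)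
            error≤2 : ∀ {x y} → x ≤ y + fromℕ 2 → x - y ≤ fromℕ 2
            error≤2 {x} {y} x≤y+2 = ≤-trans (+-monoˡ-≤ (- y) x≤y+2)
              (≤-reflexive (solve 2 (λ y t → (y :+ t) :- y := t) refl y (fromℕ 2)))

          term≤ : ∀ u v → E u v * (F u * G v) ≤
            E u v * (fromℕ (a u) * fromℕ (b v)) + fromℕ m * (∣ E u v ∣ * (fromℕ 2 * (f u + g v)))
          term≤ u v = begin
            E u v * (F u * G v)
              ≈⟨ solve 3 (λ e x y → e :* x := e :* y :+ e :* (x :- y)) refl (E u v) (F u * G v) (fromℕ (a u) * fromℕ (b v)) ⟩
            E u v * (fromℕ (a u) * fromℕ (b v)) + E u v * (F u * G v - fromℕ (a u) * fromℕ (b v))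
              ≤⟨ +-monoʳ-≤ _ (≤-trans (*-monoʳ-≤ (proj₁ (rounding u v)) (x≤∣x∣ (E u v)))
                                      (*-monoˡ-≤ (∣x∣-nonneg (E u v)) (proj₂ (rounding u v)))) ⟩
            E u v * (fromℕ (a u) * fromℕ (b v)) + ∣ E u v ∣ * (fromℕ 2 * (F u + G v))
              ≈⟨ +-congˡ (solve 5 (λ e t m f g → e :* (t :* (m :* f :+ m :* g)) := m :* (e :* (t :* (f :+ g))))
                            refl ∣ E u v ∣ (fromℕ 2) (fromℕ m) (f u) (g v)) ⟩
            E u v * (fromℕ (a u) * fromℕ (b v)) + fromℕ m * (∣ E u v ∣ * (fromℕ 2 * (f u + g v))) ∎

          normSq-scaled : ∀ (h : Fin n → Carrier) → normSq (λ u → fromℕ m * h u) ≈ fromℕ m * fromℕ m * normSq h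
          normSq-scaled h = trans
            (∑-cong λ u → solve 2 (λ m h → (m :* h) :* (m :* h) := m :* m :* (h :* h)) refl (fromℕ m) (h u))
            (sym (*-distribˡ-sum (fromℕ m * fromℕ m) λ u → h u * h u))

          square-multiple≤ : fromℕ m * (fromℕ m * (form E f g - κ * (normSq f + normSq g))) ≤ fromℕ m * slack
          square-multiple≤ = begin
            fromℕ m * (fromℕ m * (form E f g - κ * (normSq f + normSq g)))
              ≈⟨ solve 5 (λ m q k x y → m :* (m :* (q :- k :* (x :+ y))) := m :* m :* q :- k :* (m :* m :* x :+ m :* m :* y))
                   refl (fromℕ m) (form E f g) κ (normSq f) (normSq g) ⟩
            fromℕ m * fromℕ m * form E f g - κ * (fromℕ m * fromℕ m * normSq f + fromℕ m * fromℕ m * normSq g)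
              ≈⟨ +-cong (form-* E (fromℕ m) (fromℕ m) f g) (-‿cong (*-congˡ (+-cong (normSq-scaled f) (normSq-scaled g)))) ⟨
            form E F G - κ * (normSq F + normSq G)
              ≤⟨ +-monoˡ-≤ _ (∑∑-mono-≤ term≤) ⟩
            ∑ (λ u → ∑ λ v → E u v * (fromℕ (a u) * fromℕ (b v)) + fromℕ m * (∣ E u v ∣ * (fromℕ 2 * (f u + g v))))
              - κ * (normSq F + normSq G)
              ≈⟨ +-congʳ (trans (∑∑-distrib-+ (λ u v → E u v * (fromℕ (a u) * fromℕ (b v)))
                                              (λ u v → fromℕ m * (∣ E u v ∣ * (fromℕ 2 * (f u + g v)))))
                   (+-congˡ (sym (*-distribˡ-∑∑ (fromℕ m) λ u v → ∣ E u v ∣ * (fromℕ 2 * (f u + g v)))))) ⟩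
            form E (fromℕ ∘ a) (fromℕ ∘ b) + fromℕ m * slack - κ * (normSq F + normSq G)
              ≤⟨ +-monoˡ-≤ _ (+-monoˡ-≤ (fromℕ m * slack) (≤-trans (form-ℕ≤ a b)
                   (*-monoˡ-≤ 0≤κ (+-mono-≤ (∑-mono-≤ λ u → *-mono-≤ (0≤F u) (fromℕ-nonneg (a u)) (a≤F u) (a≤F u))
                                            (∑-mono-≤ λ v → *-mono-≤ (0≤G v) (fromℕ-nonneg (b v)) (b≤G v) (b≤G v)))))) ⟩
            κ * (normSq F + normSq G) + fromℕ m * slack - κ * (normSq F + normSq G)
              ≈⟨ solve 2 (λ x y → (x :+ y) :- x := y) refl (κ * (normSq F + normSq G)) (fromℕ m * slack) ⟩
            fromℕ m * slack ∎

        multiple≤ : ∀ m → fromℕ m * (form E f g - κ * (normSq f + normSq g)) ≤ slack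
        multiple≤ zero    = ≤-trans (≤-reflexive (zeroˡ _)) 0≤slack
        multiple≤ (suc m) = *-cancelˡ-≤ (fromℕ-pos (suc m)) (square-multiple≤ (suc m))

    module _ {n} (L : ℕ) (E : Fin n → Fin n → Carrier)
      (discrepancy⁺ : ∀ U V → Discrepancy L (form E (fromℕ ∘ 𝟙 ∘ U) (fromℕ ∘ 𝟙 ∘ V)) (size U) (size V))
      (discrepancy⁻ : ∀ U V → Discrepancy L (form (λ u v → - E u v) (fromℕ ∘ 𝟙 ∘ U) (fromℕ ∘ 𝟙 ∘ V)) (size U) (size V)) where

      -- With p = 2h⁺ and q = 2h⁻, four times the form is E(p,p) - E(p,q) + E(q,q) - E(q,p); the
      -- negative mixed terms are why - E has to be controlled too. The four bounds add up to
      -- 4κ(|p|² + |q|²) = 16κ|h|², whence the factor 4.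
      form≤ : ∀ (h : Fin n → Carrier) → form E h h ≤ fromℕ 4 * (ε * fromℕ (2 ℕ.* L ℕ.+ 2)) * normSq h
      form≤ h = *-cancelˡ-≤ (fromℕ-pos 4) (begin
        fromℕ 4 * form E h h
          ≈⟨ expand ⟩
        (form E p p + form (λ u v → - E u v) p q) + (form E q q + form (λ u v → - E u v) q p)
          ≤⟨ +-mono-≤ (+-mono-≤ (form-nonneg≤ L E discrepancy⁺ p p 0≤p 0≤p) (form-nonneg≤ L (λ u v → - E u v) discrepancy⁻ p q 0≤p 0≤q))
                      (+-mono-≤ (form-nonneg≤ L E discrepancy⁺ q q 0≤q 0≤q) (form-nonneg≤ L (λ u v → - E u v) discrepancy⁻ q p 0≤q 0≤p)) ⟩
        (κ * (normSq p + normSq p) + κ * (normSq p + normSq q)) + (κ * (normSq q + normSq q) + κ * (normSq q + normSq p))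
          ≈⟨ solve 3 (λ k p q → (k :* (p :+ p) :+ k :* (p :+ q)) :+ (k :* (q :+ q) :+ k :* (q :+ p))
                              := (con (+ 4) :* k) :* (p :+ q)) refl κ (normSq p) (normSq q) ⟩
        (4# * κ) * (normSq p + normSq q)
          ≈⟨ *-congˡ normSq-split ⟩
        (4# * κ) * (4# * normSq h)
          ≈⟨ solve 2 (λ k x → (con (+ 4) :* k) :* (con (+ 4) :* x)
               := fromℕ4 :* (fromℕ4 :* k :* x)) refl κ (normSq h) ⟩
        fromℕ 4 * (fromℕ 4 * κ * normSq h) ∎)
        where
        κ 4# : Carrier
        κ  = ε * fromℕ (2 ℕ.* L ℕ.+ 2)
        4# = 1# + 1# + 1# + 1#
        -- Spelled out so that it denotes `fromℕ 4` literally, with its trailing zero; `con (+ 4)`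
        -- denotes `4#` instead.
        fromℕ4 : ∀ {k} → _
        fromℕ4 {k} = con {k} (+ 1) :+ (con (+ 1) :+ (con (+ 1) :+ (con (+ 1) :+ con (+ 0))))
        -- twice the positive and negative parts of h
        p q : Fin n → Carrier
        p u = ∣ h u ∣ + h u
        q u = ∣ h u ∣ - h u

        0≤p : ∀ u → 0# ≤ p u
        0≤p u = ≤-trans (x≤y⇒0≤y-x (-x≤∣x∣ (h u)))
          (≤-reflexive (solve 2 (λ a h → a :- (:- h) := a :+ h) refl ∣ h u ∣ (h u)))
        0≤q : ∀ u → 0# ≤ q u
        0≤q u = x≤y⇒0≤y-x (x≤∣x∣ (h u))

        expand : fromℕ 4 * form E h h ≈
          (form E p p + form (λ u v → - E u v) p q) + (form E q q + form (λ u v → - E u v) q p)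
        expand = begin-equality
          fromℕ 4 * form E h h
            ≈⟨ *-distribˡ-∑∑ (fromℕ 4) (λ u v → E u v * (h u * h v)) ⟩
          ∑ (λ u → ∑ λ v → fromℕ 4 * (E u v * (h u * h v)))
            ≈⟨ ∑∑-cong (λ u v → solve 5 (λ e h h′ a a′ → fromℕ4 :* (e :* (h :* h′))
                 := (e :* ((a :+ h) :* (a′ :+ h′)) :+ (:- e) :* ((a :+ h) :* (a′ :- h′)))
                 :+ (e :* ((a :- h) :* (a′ :- h′)) :+ (:- e) :* ((a :- h) :* (a′ :+ h′))))
                 refl (E u v) (h u) (h v) ∣ h u ∣ ∣ h v ∣) ⟩
          ∑ (λ u → ∑ λ v → (E u v * (p u * p v) + - E u v * (p u * q v)) + (E u v * (q u * q v) + - E u v * (q u * p v)))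
            ≈⟨ trans (∑∑-distrib-+ (λ u v → E u v * (p u * p v) + - E u v * (p u * q v)) _)
                 (+-cong (∑∑-distrib-+ (λ u v → E u v * (p u * p v)) _) (∑∑-distrib-+ (λ u v → E u v * (q u * q v)) _)) ⟩
          (form E p p + form (λ u v → - E u v) p q) + (form E q q + form (λ u v → - E u v) q p) ∎

        normSq-split : normSq p + normSq q ≈ 4# * normSq h
        normSq-split = begin-equality
          normSq p + normSq q
            ≈⟨ ∑-distrib-+ (λ u → p u * p u) (λ u → q u * q u) ⟨
          ∑ (λ u → p u * p u + q u * q u)
            ≈⟨ ∑-cong (λ u → trans
                 (solve 2 (λ a h → (a :+ h) :* (a :+ h) :+ (a :- h) :* (a :- h) := con (+ 2) :* (a :* a) :+ con (+ 2) :* (h :* h))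
                    refl ∣ h u ∣ (h u))
                 (trans (+-congʳ (*-congˡ (∣x∣*∣x∣≈x*x (h u))))
                   (solve 1 (λ x → con (+ 2) :* x :+ con (+ 2) :* x := con (+ 4) :* x) refl (h u * h u)))) ⟩
          ∑ (λ u → 4# * (h u * h u))
            ≈⟨ *-distribˡ-sum 4# (λ u → h u * h u) ⟨
          4# * normSq h ∎

-- Second eigenvalue and test vectors

module CourantFischer {c ℓ₁ ℓ₂} (ℝ : RealNumbers c ℓ₁ ℓ₂) {n : ℕ} where
  open RealNumbers ℝ hiding (zero)
  open OrderedFieldProperties ℝ
  open BilinearForms ℝ
  open Eigenvalues ℝ {n}
  open ≤-Reasoning

  infix 7 _∙_
  _∙_ : Vector → Vector → Carrier
  v ∙ w = ∑ λ i → v i * w i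

  ∙-comm : ∀ v w → v ∙ w ≈ w ∙ v
  ∙-comm v w = ∑-cong λ i → *-comm (v i) (w i)

  infixr 8 _$_
  _$_ : Matrix → Vector → Vector
  (M $ v) i = ∑ λ j → M i j * v j

  combination : Carrier → Carrier → Vector → Vector → Vector
  combination a b v w i = a * v i + b * w i

  ∙-combination : ∀ u a b v w → u ∙ combination a b v w ≈ a * (u ∙ v) + b * (u ∙ w)
  ∙-combination u a b v w = begin-equality
    ∑ (λ i → u i * (a * v i + b * w i))
      ≈⟨ ∑-cong (λ i → solve 5 (λ u a b v w → u :* (a :* v :+ b :* w) := a :* (u :* v) :+ b :* (u :* w))
                         refl (u i) a b (v i) (w i)) ⟩
    ∑ (λ i → a * (u i * v i) + b * (u i * w i))
      ≈⟨ ∑-distrib-+ (λ i → a * (u i * v i)) (λ i → b * (u i * w i)) ⟩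
    ∑ (λ i → a * (u i * v i)) + ∑ (λ i → b * (u i * w i))
      ≈⟨ +-cong (*-distribˡ-sum a λ i → u i * v i) (*-distribˡ-sum b λ i → u i * w i) ⟨
    a * (u ∙ v) + b * (u ∙ w) ∎

  combination-∙ : ∀ u a b v w → combination a b v w ∙ u ≈ a * (v ∙ u) + b * (w ∙ u)
  combination-∙ u a b v w = trans (∙-comm _ u)
    (trans (∙-combination u a b v w) (+-cong (*-congˡ (∙-comm u v)) (*-congˡ (∙-comm u w))))

  $-symmetric : ∀ M → (∀ i j → M i j ≈ M j i) → ∀ v w → v ∙ (M $ w) ≈ w ∙ (M $ v)
  $-symmetric M M-sym v w = begin-equality
    ∑ (λ i → v i * ∑ λ j → M i j * w j)        ≈⟨ ∑-cong (λ i → *-distribˡ-sum (v i) λ j → M i j * w j) ⟩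
    ∑ (λ i → ∑ λ j → v i * (M i j * w j))      ≈⟨ ∑-comm (λ i j → v i * (M i j * w j)) ⟩
    ∑ (λ j → ∑ λ i → v i * (M i j * w j))      ≈⟨ ∑∑-cong (λ j i → trans (*-congˡ (*-congʳ (M-sym i j)))
                                                    (solve 3 (λ v m w → v :* (m :* w) := w :* (m :* v)) refl (v i) (M j i) (w j))) ⟩
    ∑ (λ j → ∑ λ i → w j * (M j i * v i))      ≈⟨ ∑-cong (λ j → *-distribˡ-sum (w j) λ i → M j i * v i) ⟨
    ∑ (λ j → w j * ∑ λ i → M j i * v i)        ∎

  ∙-eigenvector : ∀ {M μ v} → IsEigenpair M μ v → ∀ w → w ∙ (M $ v) ≈ μ * (w ∙ v)
  ∙-eigenvector {μ = μ} {v} Mv≈μv w = trans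
    (∑-cong λ i → trans (*-congˡ (Mv≈μv i)) (solve 3 (λ w μ v → w :* (μ :* v) := μ :* (w :* v)) refl (w i) μ (v i)))
    (sym (*-distribˡ-sum μ λ i → w i * v i))

  ∙-self≤0⇒≈0 : ∀ {v : Vector} → v ∙ v ≤ 0# → ∀ i → v i ≈ 0#
  ∙-self≤0⇒≈0 {v} vv≤0 i = x*x≈0⇒x≈0 (∑-nonneg≈0 (λ j → x*x-nonneg (v j)) vv≤0 i)

  module _ (M : Matrix) (M-sym : ∀ i j → M i j ≈ M j i) {μ₁ μ₂ : Carrier} {v₁ v₂ : Vector} (μ₁≤μ₂ : μ₁ ≤ μ₂)
    (pair₁ : IsEigenpair M μ₁ v₁) (pair₂ : IsEigenpair M μ₂ v₂) where

    -- The factor is kept because equality of the eigenvalues is undecidable, and eigenvectors of a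
    -- common eigenvalue may fail to be orthogonal.
    eigenvectors-orthogonal : (μ₂ - μ₁) * (v₁ ∙ v₂) ≈ 0#
    eigenvectors-orthogonal = begin-equality
      (μ₂ - μ₁) * (v₁ ∙ v₂)
        ≈⟨ solve 3 (λ a b x → (b :- a) :* x := b :* x :- a :* x) refl μ₁ μ₂ (v₁ ∙ v₂) ⟩
      μ₂ * (v₁ ∙ v₂) - μ₁ * (v₁ ∙ v₂)
        ≈⟨ +-cong (sym (∙-eigenvector pair₂ v₁)) (-‿cong (trans (*-congˡ (∙-comm v₁ v₂)) (sym (∙-eigenvector pair₁ v₂)))) ⟩
      v₁ ∙ (M $ v₂) - v₂ ∙ (M $ v₁)
        ≈⟨ +-congʳ ($-symmetric M M-sym v₁ v₂) ⟩
      v₂ ∙ (M $ v₁) - v₂ ∙ (M $ v₁)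
        ≈⟨ -‿inverseʳ _ ⟩
      0# ∎

    -- The difference of the two sides is (μ₂ - μ₁) a² |v₁|² plus the cross term (μ₂ - μ₁) ab (v₁ ∙
    -- v₂), which vanishes by `eigenvectors-orthogonal`.
    Rayleigh-combination≤ : ∀ a b → let w = combination a b v₁ v₂ in w ∙ (M $ w) ≤ μ₂ * (w ∙ w)
    Rayleigh-combination≤ a b = ≤-from-diff
      (*-nonneg (x≤y⇒0≤y-x μ₁≤μ₂) (*-nonneg (x*x-nonneg a) (normSq-nonneg v₁))) (begin-equality
        (μ₂ - μ₁) * (a * a * P)
          ≈⟨ +-identityʳ _ ⟨
        (μ₂ - μ₁) * (a * a * P) + 0#
          ≈⟨ +-congˡ (trans (*-congˡ eigenvectors-orthogonal) (zeroʳ (a * b))) ⟨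
        (μ₂ - μ₁) * (a * a * P) + a * b * ((μ₂ - μ₁) * Q)
          ≈⟨ solve 7 (λ m n a b p q r → (n :- m) :* (a :* a :* p) :+ a :* b :* ((n :- m) :* q)
               := n :* (a :* (a :* p :+ b :* q) :+ b :* (a :* q :+ b :* r))
                  :- (a :* (m :* (a :* p :+ b :* q)) :+ b :* (n :* (a :* q :+ b :* r)))) refl μ₁ μ₂ a b P Q R ⟩
        μ₂ * (a * (a * P + b * Q) + b * (a * Q + b * R)) - (a * (μ₁ * (a * P + b * Q)) + b * (μ₂ * (a * Q + b * R)))
          ≈⟨ +-cong (*-congˡ (trans (∙-combination w a b v₁ v₂) (+-cong (*-congˡ w∙v₁) (*-congˡ w∙v₂))))
                    (-‿cong (trans w∙Mw (+-cong (*-congˡ (trans (∙-eigenvector pair₁ w) (*-congˡ w∙v₁)))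
                                                (*-congˡ (trans (∙-eigenvector pair₂ w) (*-congˡ w∙v₂)))))) ⟨
        μ₂ * (w ∙ w) - w ∙ (M $ w) ∎)
      where
      w : Vector
      w = combination a b v₁ v₂
      P Q R : Carrier
      P = v₁ ∙ v₁
      Q = v₁ ∙ v₂
      R = v₂ ∙ v₂
      w∙v₁ : w ∙ v₁ ≈ a * P + b * Q
      w∙v₁ = trans (combination-∙ v₁ a b v₁ v₂) (+-congˡ (*-congˡ (∙-comm v₂ v₁)))
      w∙v₂ : w ∙ v₂ ≈ a * Q + b * R
      w∙v₂ = combination-∙ v₂ a b v₁ v₂
      w∙Mw : w ∙ (M $ w) ≈ a * (w ∙ (M $ v₁)) + b * (w ∙ (M $ v₂))
      w∙Mw = trans (∑-cong λ i → *-congˡ (∙-combination (M i) a b v₁ v₂)) (∙-combination w a b (M $ v₁) (M $ v₂))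

  -- With α = f ∙ v₁ and β = f ∙ v₂, the combination β v₁ − α v₂ is a test vector unless it vanishes;
  -- in that case β = 0, and v₂ itself is one.
  AreTwoEigenvalues⇒≥ : ∀ M → (∀ i j → M i j ≈ M j i) → (f : Vector) (θ : Carrier) →
    (∀ w → f ∙ w ≈ 0# → θ * (w ∙ w) ≤ w ∙ (M $ w)) →
    ∀ {μ₁ μ₂} → AreTwoEigenvalues M μ₁ μ₂ → θ ≤ μ₂
  AreTwoEigenvalues⇒≥ M M-sym f θ bound {μ₁} {μ₂} (μ₁≤μ₂ , v₁ , v₂ , independent , pair₁ , pair₂) μ₂<θ =
    <-irrefl (sym 1≈0) 0<1
    where
    α β : Carrier
    α = f ∙ v₁
    β = f ∙ v₂

    -- If `μ₂ < θ`, a combination orthogonal to `f` has (θ - μ₂)|w|² ≤ 0, hence is zero, and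
    -- independence kills both coefficients. Used twice, this makes β and then 1 equal to zero, with
    -- no decision about α or β.
    vanishing : ∀ a b → f ∙ combination a b v₁ v₂ ≈ 0# → (a ≈ 0#) × (b ≈ 0#)
    vanishing a b f∙w≈0 = independent a b (∙-self≤0⇒≈0 {w} (*-cancelˡ-≤ (x<y⇒0<y-x μ₂<θ) (begin
      (θ - μ₂) * (w ∙ w)           ≈⟨ solve 3 (λ t m x → (t :- m) :* x := t :* x :- m :* x) refl θ μ₂ (w ∙ w) ⟩
      θ * (w ∙ w) - μ₂ * (w ∙ w)   ≤⟨ +-monoˡ-≤ _ (≤-trans (bound w f∙w≈0) (Rayleigh-combination≤ M M-sym μ₁≤μ₂ pair₁ pair₂ a b)) ⟩
      μ₂ * (w ∙ w) - μ₂ * (w ∙ w)  ≈⟨ -‿inverseʳ _ ⟩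
      0#                           ≈⟨ zeroʳ (θ - μ₂) ⟨
      (θ - μ₂) * 0#                ∎)))
      where
      w : Vector
      w = combination a b v₁ v₂

    β≈0 : β ≈ 0#
    β≈0 = proj₁ (vanishing β (- α) (trans (∙-combination f β (- α) v₁ v₂)
      (solve 2 (λ a b → b :* a :+ (:- a) :* b := con (+ 0)) refl α β)))

    1≈0 : 1# ≈ 0#
    1≈0 = proj₂ (vanishing 0# 1# (trans (∙-combination f 0# 1# v₁ v₂)
      (trans (solve 2 (λ a b → con (+ 0) :* a :+ con (+ 1) :* b := b) refl α β) β≈0)))

-- Estimates for the logarithm

module Logarithm {c ℓ₁ ℓ₂} (ℝ : RealNumbers c ℓ₁ ℓ₂) where
  open RealNumbers ℝ hiding (zero)
  open OrderedFieldProperties ℝ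
  open ≤-Reasoning

  log-1 : ∀ p → log 1# p ≈ 0#
  log-1 p = begin-equality
    log 1# p                        ≈⟨ solve 1 (λ l → l := (l :+ l) :- l) refl (log 1# p) ⟩
    (log 1# p + log 1# p) - log 1# p  ≈⟨ +-congʳ (trans (log-cong p 0<1*1 (sym (*-identityˡ 1#))) (log-* p p 0<1*1)) ⟨
    log 1# p - log 1# p             ≈⟨ -‿inverseʳ _ ⟩
    0#                              ∎
    where
    0<1*1 : 0# < 1# * 1#
    0<1*1 = *-pos p p

  -- Applying `log-≤` to the inverse gives log x ≥ 1 - 1/x.
  x-1≤x*log : ∀ {x} (p : 0# < x) → x - 1# ≤ x * log x p
  x-1≤x*log {x} p = let (x⁻¹ , q , xx⁻¹≈1) = inverse x p in begin
    x - 1#                       ≈⟨ +-cong (*-identityʳ x) (-‿cong xx⁻¹≈1) ⟨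
    x * 1# - x * x⁻¹             ≈⟨ solve 2 (λ x y → x :* con (+ 1) :- x :* y := x :* (:- (y :- con (+ 1)))) refl x x⁻¹ ⟩
    x * - (x⁻¹ - 1#)             ≤⟨ *-monoˡ-≤ (<⇒≤ p) (-‿antimono-≤ (log-≤ q)) ⟩
    x * - log x⁻¹ q              ≈⟨ *-congˡ (solve 2 (λ l m → :- m := l :- (l :+ m)) refl (log x p) (log x⁻¹ q)) ⟩
    x * (log x p - (log x p + log x⁻¹ q))
                                 ≈⟨ *-congˡ (+-congˡ (-‿cong (trans (sym (log-* p q (*-pos p q)))
                                      (trans (log-cong (*-pos p q) 0<1 xx⁻¹≈1) (log-1 0<1))))) ⟩
    x * (log x p - 0#)           ≈⟨ *-congˡ (solve 1 (λ l → l :- con (+ 0) := l) refl (log x p)) ⟩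
    x * log x p                  ∎

  -- Split log x = log y + log (x/y), where log (x/y) ≤ x/y - 1 ≤ 0.
  log-mono-≤ : ∀ {x y} (p : 0# < x) (q : 0# < y) → x ≤ y → log x p ≤ log y q
  log-mono-≤ {x} {y} p q x≤y = begin
    log x p                  ≈⟨ log-cong p r (sym (trans (*-comm y z) (/-*-cancel x q))) ⟩
    log (y * z) r            ≈⟨ log-* q (/-pos p q) r ⟩
    log y q + log z (/-pos p q)  ≤⟨ +-monoʳ-≤ (log y q) (log-≤ (/-pos p q)) ⟩
    log y q + (z - 1#)       ≤⟨ +-monoʳ-≤ (log y q) (+-monoˡ-≤ (- 1#) z≤1) ⟩
    log y q + (1# - 1#)      ≈⟨ solve 1 (λ l → l :+ (con (+ 1) :- con (+ 1)) := l) refl (log y q) ⟩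
    log y q                  ∎
    where
    z : Carrier
    z = x / y ∵ q
    r : 0# < y * z
    r = *-pos q (/-pos p q)
    z≤1 : z ≤ 1#
    z≤1 = *-cancelˡ-≤ q (begin
      y * z   ≈⟨ trans (*-comm y z) (/-*-cancel x q) ⟩
      x       ≤⟨ x≤y ⟩
      y       ≈⟨ *-identityʳ y ⟨
      y * 1#  ∎)

  log-nonneg : ∀ {x} (p : 0# < x) → 1# ≤ x → 0# ≤ log x p
  log-nonneg p 1≤x = ≤-trans (≤-reflexive (sym (log-1 0<1))) (log-mono-≤ 0<1 p 1≤x)

  -- This rests on log 2 ≥ 1/2, which is `x-1≤x*log` at 2.
  n≤2*log[2^n] : ∀ n (p : 0# < fromℕ (2 ℕ.^ n)) → fromℕ n ≤ fromℕ 2 * log (fromℕ (2 ℕ.^ n)) p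
  n≤2*log[2^n] zero    p = *-nonneg (fromℕ-nonneg 2) (log-nonneg p (≤-reflexive (sym fromℕ-1)))
  n≤2*log[2^n] (suc n) p = begin
    1# + fromℕ n
      ≤⟨ +-mono-≤ 1≤2log2 (n≤2*log[2^n] n q) ⟩
    fromℕ 2 * log (fromℕ 2) (fromℕ-pos 2) + fromℕ 2 * log (fromℕ (2 ℕ.^ n)) q
      ≈⟨ distribˡ (fromℕ 2) _ _ ⟨
    fromℕ 2 * (log (fromℕ 2) (fromℕ-pos 2) + log (fromℕ (2 ℕ.^ n)) q)
      ≈⟨ *-congˡ (trans (log-cong p (*-pos (fromℕ-pos 2) q) (fromℕ-* 2 (2 ℕ.^ n))) (log-* (fromℕ-pos 2) q (*-pos (fromℕ-pos 2) q))) ⟨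
    fromℕ 2 * log (fromℕ (2 ℕ.^ suc n)) p ∎
    where
    q : 0# < fromℕ (2 ℕ.^ n)
    q = fromℕ-pos (2 ℕ.^ n) {{ℕ.m^n≢0 2 n}}
    1≤2log2 : 1# ≤ fromℕ 2 * log (fromℕ 2) (fromℕ-pos 2)
    1≤2log2 = ≤-trans (≤-reflexive (solve 0 (con (+ 1) := (con (+ 1) :+ (con (+ 1) :+ con (+ 0))) :- con (+ 1)) refl))
                      (x-1≤x*log (fromℕ-pos 2))

  -- An approximate ceiling of the binary logarithm. Cotransitivity can only locate x between 2^n
  -- and 2^(n + 2), so k = n + 2 may be too large by up to 2; hence the additive constant.
  binary-length : ∀ {x} (p : 0# < x) → 1# ≤ x →
    ∃[ k ] (x ≤ fromℕ (2 ℕ.^ k) × fromℕ k ≤ fromℕ 2 + fromℕ 2 * log x p)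
  binary-length {x} p 1≤x = let (n , x<n) = archimedean x in
    below n (<-≤-trans x<n (fromℕ-mono-≤ (ℕ.<⇒≤ (n<2^n n))))
    where
    k≤2 : ∀ {k} → k ℕ.≤ 2 → fromℕ k ≤ fromℕ 2 + fromℕ 2 * log x p
    k≤2 k≤2 = ≤-trans (fromℕ-mono-≤ k≤2) (x≤x+y (fromℕ 2) (*-nonneg (fromℕ-nonneg 2) (log-nonneg p 1≤x)))

    below : ∀ n → x < fromℕ (2 ℕ.^ n) →
      ∃[ k ] (x ≤ fromℕ (2 ℕ.^ k) × fromℕ k ≤ fromℕ 2 + fromℕ 2 * log x p)
    below 0             x<1 = 0 , <⇒≤ x<1 , k≤2 z≤n
    below 1             x<2 = 1 , <⇒≤ x<2 , k≤2 (s≤s z≤n)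
    below (suc (suc n)) x<2^[2+n] = [ here , below (suc n) ]′
      (<-cotrans (<-≤-trans (fromℕ-n<1+n (2 ℕ.^ n)) (fromℕ-mono-≤ (ℕ.^-monoʳ-< 2 (s≤s (s≤s z≤n)) (ℕ.n<1+n n)))) x)
      where
      here : fromℕ (2 ℕ.^ n) < x → ∃[ k ] (x ≤ fromℕ (2 ℕ.^ k) × fromℕ k ≤ fromℕ 2 + fromℕ 2 * log x p)
      here 2^n<x = suc (suc n) , <⇒≤ x<2^[2+n] , (begin
        fromℕ (2 ℕ.+ n)                                ≈⟨ fromℕ-+ 2 n ⟩
        fromℕ 2 + fromℕ n                              ≤⟨ +-monoʳ-≤ (fromℕ 2) (n≤2*log[2^n] n q) ⟩
        fromℕ 2 + fromℕ 2 * log (fromℕ (2 ℕ.^ n)) q    ≤⟨ +-monoʳ-≤ (fromℕ 2) (*-monoˡ-≤ (fromℕ-nonneg 2) (log-mono-≤ q p (<⇒≤ 2^n<x))) ⟩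
        fromℕ 2 + fromℕ 2 * log x p                    ∎)
        where
        q : 0# < fromℕ (2 ℕ.^ n)
        q = fromℕ-pos (2 ℕ.^ n) {{ℕ.m^n≢0 2 n}}

  -- The origin of the threshold 4: from there on, additive constants can be absorbed into multiples
  -- of the logarithm.
  1≤log : ∀ {x} (p : 0# < x) → fromℕ 4 ≤ x → 1# ≤ log x p
  1≤log {x} p 4≤x = *-cancelˡ-≤ (fromℕ-pos 2) (begin
    fromℕ 2 * 1#                              ≈⟨ *-identityʳ _ ⟩
    fromℕ 2                                   ≤⟨ n≤2*log[2^n] 2 (fromℕ-pos 4) ⟩
    fromℕ 2 * log (fromℕ 4) (fromℕ-pos 4)     ≤⟨ *-monoˡ-≤ (fromℕ-nonneg 2) (log-mono-≤ (fromℕ-pos 4) p 4≤x) ⟩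
    fromℕ 2 * log x p                         ∎)

-- Subsets as indicator functions

module Indicators where
  open import Data.Fin.Subset using (∣_∣)
  open import Data.Nat.Base using (_+_; _*_; _≤_)
  open ℕ-Sum
  open ≡ using (refl; cong; cong₂; sym; trans)

  ∣∣≡size : ∀ {n} (S : Subset n) → ∣ S ∣ ≡ size (lookup S)
  ∣∣≡size []          = refl
  ∣∣≡size (true  ∷ S) = cong suc (∣∣≡size S)
  ∣∣≡size (false ∷ S) = ∣∣≡size S

  does-∈? : ∀ {n} (S : Subset n) i → does (i ∈? S) ≡ lookup S i
  does-∈? (true  ∷ S) zero    = refl
  does-∈? (false ∷ S) zero    = refl
  does-∈? (_     ∷ S) (suc i) = does-∈? S i

  sum-elements : ∀ {n} (S : Subset n) (h : Fin n → ℕ) →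
    sumˡ (map h (elements S)) ≡ sum (λ i → 𝟙 (lookup S i) * h i)
  sum-elements S h = go id
    where
    -- Generalized from `id`, because the tail of `allFin` is a tabulation along `suc`.
    go : ∀ {m} (f : Fin m → Fin _) →
      sumˡ (map h (filter (_∈? S) (List.tabulate f))) ≡ sum (λ i → 𝟙 (lookup S (f i)) * h (f i))
    go {zero}  f = refl
    go {suc m} f rewrite sym (does-∈? S (f zero)) with does (f zero ∈? S)
    ... | true  = cong₂ _+_ (sym (ℕ.*-identityˡ (h (f zero)))) (go (f ∘ suc))
    ... | false = go (f ∘ suc)

  ∈-elements : ∀ {n} {S : Subset n} {v} → v ∈ S → v ∈ˡ elements S
  ∈-elements v∈S = ∈-filter⁺ (_∈? _) (∈-allFin _) v∈S

  𝟙-∧ : ∀ a b → 𝟙 (a ∧ b) ≡ 𝟙 a * 𝟙 b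
  𝟙-∧ true  b = sym (ℕ.*-identityˡ (𝟙 b))
  𝟙-∧ false b = refl

  𝟙≤1 : ∀ b → 𝟙 b ≤ 1
  𝟙≤1 true  = s≤s z≤n
  𝟙≤1 false = z≤n

  -- Digit sets of a vector on all vertices may meet both parts, whereas the discrepancy hypothesis
  -- speaks of subsets of X and of Y; it is applied to the traces of the digit sets.
  restrict : ∀ {n} → (Fin n → Bool) → Subset n → Subset n
  restrict U S = tabulate λ u → U u ∧ lookup S u

  module _ {n} (U : Fin n → Bool) (S : Subset n) where

    𝟙-restrict : ∀ u → 𝟙 (lookup (restrict U S) u) ≡ 𝟙 (U u) ℕ.* 𝟙 (lookup S u)
    𝟙-restrict u = ≡.trans (≡.cong 𝟙 (lookup∘tabulate _ u)) (𝟙-∧ (U u) (lookup S u))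

    restrict⊆ : ∀ {u} → u ∈ restrict U S → u ∈ S
    restrict⊆ {u} u∈ with U u | lookup S u in eq | ≡.trans (≡.sym (lookup∘tabulate (λ u → U u ∧ lookup S u) u)) ([]=⇒lookup u∈)
    ... | true | true | _ = lookup⇒[]= u S eq

    ∣restrict∣≤size : ∣ restrict U S ∣ ℕ.≤ size U
    ∣restrict∣≤size = ℕ.≤-trans (ℕ.≤-reflexive (∣∣≡size (restrict U S))) (sum-mono-≤ λ u →
      ℕ.≤-trans (ℕ.≤-reflexive (𝟙-restrict u))
        (ℕ.≤-trans (ℕ.*-monoʳ-≤ (𝟙 (U u)) (𝟙≤1 (lookup S u))) (ℕ.≤-reflexive (ℕ.*-identityʳ _))))

open Indicators

-- Edge counts in a bipartite graph

module Counting (G : ConnectedBipartiteGraph) where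
  open ConnectedBipartiteGraph G
  open Dyadic using (sum-mono-≤)
  open import Data.Nat.Base
  open import Data.Nat.Properties
  open import Data.Fin.Subset using (∣_∣)
  open ℕ-Sum
  open ≤-Reasoning
  open ≡ using (refl; cong; cong₂; sym; trans)

  A : Fin n → Fin n → ℕ
  A u v = 𝟙 (adj u v)

  A-sym : ∀ u v → A u v ≡ A v u
  A-sym u v = cong 𝟙 (adj-sym u v)

  x y : Fin n → ℕ
  x u = 𝟙 (lookup X u)
  y v = 𝟙 (lookup Y v)

  ∣tabulate∣≡size : ∀ {m} (U : Fin m → Bool) → ∣ tabulate U ∣ ≡ size U
  ∣tabulate∣≡size U = trans (∣∣≡size (tabulate U)) (sum-cong-≗ λ v → cong 𝟙 (lookup∘tabulate U v))

  degree≡ : ∀ u → degree u ≡ sum (A u)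
  degree≡ u = ∣tabulate∣≡size (adj u)

  x+y≡1 : ∀ u → x u + y u ≡ 1
  x+y≡1 u with lookup X u in eqX | lookup Y u in eqY
  ... | true  | true  = contradiction (lookup⇒[]= u Y eqY) (disjoint (lookup⇒[]= u X eqX))
  ... | true  | false = refl
  ... | false | true  = refl
  ... | false | false with cover u
  ...   | inj₁ u∈X = contradiction (trans (sym eqX) ([]=⇒lookup u∈X)) λ ()
  ...   | inj₂ u∈Y = contradiction (trans (sym eqY) ([]=⇒lookup u∈Y)) λ ()

  xA≡xAy : ∀ u v → x u * A u v ≡ x u * (A u v * y v)
  xA≡xAy u v with lookup X u in eqX | adj u v in eqA
  ... | false | _     = refl
  ... | true  | false = refl
  ... | true  | true  rewrite []=⇒lookup (X⇒Y eqA (lookup⇒[]= u X eqX)) = refl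

  yA≡yAx : ∀ u v → y u * A u v ≡ y u * (A u v * x v)
  yA≡yAx u v with lookup Y u in eqY | adj u v in eqA
  ... | false | _     = refl
  ... | true  | false = refl
  ... | true  | true  rewrite []=⇒lookup (Y⇒X eqA (lookup⇒[]= u Y eqY)) = refl

  -- The two off-diagonal blocks of a bipartite adjacency matrix. They are transposes of each other,
  -- so they contribute equally to a quadratic form.
  A-split : ∀ u v → A u v ≡ x u * (A u v * y v) + y u * (A u v * x v)
  A-split u v = begin-equality
    A u v                                        ≡⟨ *-identityˡ (A u v) ⟨
    1 * A u v                                    ≡⟨ cong (_* A u v) (x+y≡1 u) ⟨
    (x u + y u) * A u v                          ≡⟨ *-distribʳ-+ (A u v) (x u) (y u) ⟩
    x u * A u v + y u * A u v                    ≡⟨ cong₂ _+_ (xA≡xAy u v) (yA≡yAx u v) ⟩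
    x u * (A u v * y v) + y u * (A u v * x v)    ∎

  -- The common value of the two degree sums, which links the averages by |X| d̄ = |Y| c̄.
  edges : ℕ
  edges = sum λ u → sum λ v → x u * (A u v * y v)

  sum-degrees-X : sumˡ (degrees X) ≡ edges
  sum-degrees-X = trans (sum-elements X degree) (sum-cong-≗ λ u → trans (cong (x u *_) (degree≡ u))
    (trans (*-distribˡ-sum (x u) (A u)) (sum-cong-≗ λ v → xA≡xAy u v)))

  sum-degrees-Y : sumˡ (degrees Y) ≡ edges
  sum-degrees-Y = trans (sum-elements Y degree) (trans (sum-cong-≗ λ v → trans (cong (y v *_) (degree≡ v))
    (trans (*-distribˡ-sum (y v) (A v)) (sum-cong-≗ λ u → trans (yA≡yAx v u)
      (trans (cong (λ a → y v * (a * x u)) (A-sym v u))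
        (solve 3 (λ y a x → y :* (a :* x) := x :* (a :* y)) refl (y v) (A u v) (x u))))))
    (∑-comm λ v u → x u * (A u v * y v)))
    where open ℕ-Solver

  e≡ : ∀ U V → e U V ≡ sum λ u → sum λ v → 𝟙 (lookup U u) * (A u v * 𝟙 (lookup V v))
  e≡ U V = trans (sum-elements U λ u → ∣ neighbours u ∩ V ∣) (sum-cong-≗ λ u →
    trans (cong (𝟙 (lookup U u) *_) (trans (∣∣≡size (neighbours u ∩ V)) (sum-cong-≗ λ v →
            trans (cong 𝟙 (trans (lookup-zipWith _∧_ v (neighbours u) V) (cong (_∧ lookup V v) (lookup∘tabulate (adj u) v))))
                  (𝟙-∧ (adj u v) (lookup V v)))))
          (*-distribˡ-sum (𝟙 (lookup U u)) λ v → A u v * 𝟙 (lookup V v)))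

  degree≤Δ : ∀ u → degree u ≤ Δ
  degree≤Δ u = v≤max⁺ 0 (degrees ⊤)
    (inj₂ (Any.map ≤-reflexive (∈-map⁺ degree (∈-elements (∈⊤ {x = u})))))

  δ≤degree : ∀ u → δ ≤ degree u
  δ≤degree u = min≤v⁺ n (degrees ⊤) (inj₂ (Any.map (≤-reflexive ∘ sym) (∈-map⁺ degree (∈-elements (∈⊤ {x = u})))))

  e-sym : ∀ U V → e U V ≡ e V U
  e-sym U V = trans (e≡ U V) (trans (∑-comm λ u v → 𝟙 (lookup U u) * (A u v * 𝟙 (lookup V v)))
    (trans (sum-cong-≗ λ v → sum-cong-≗ λ u → trans (cong (λ a → 𝟙 (lookup U u) * (a * 𝟙 (lookup V v))) (A-sym u v))
        (solve 3 (λ y a x → y :* (a :* x) := x :* (a :* y)) refl (𝟙 (lookup U u)) (A v u) (𝟙 (lookup V v))))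
      (sym (e≡ V U))))
    where open ℕ-Solver

  e≤Δ*∣∣ : ∀ U V → e U V ≤ Δ * ∣ U ∣
  e≤Δ*∣∣ U V = begin
    e U V                                                                  ≡⟨ e≡ U V ⟩
    sum (λ u → sum λ v → 𝟙 (lookup U u) * (A u v * 𝟙 (lookup V v)))        ≤⟨ sum-mono-≤ row≤ ⟩
    sum (λ u → Δ * 𝟙 (lookup U u))                                         ≡⟨ *-distribˡ-sum Δ (𝟙 ∘ lookup U) ⟨
    Δ * size (lookup U)                                                    ≡⟨ cong (Δ *_) (∣∣≡size U) ⟨
    Δ * ∣ U ∣                                                              ∎
    where
    row≤ : ∀ u → sum (λ v → 𝟙 (lookup U u) * (A u v * 𝟙 (lookup V v))) ≤ Δ * 𝟙 (lookup U u)
    row≤ u = begin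
      sum (λ v → 𝟙 (lookup U u) * (A u v * 𝟙 (lookup V v)))   ≤⟨ sum-mono-≤ (λ v → *-monoʳ-≤ (𝟙 (lookup U u)) (*-monoʳ-≤ (A u v) (𝟙≤1 (lookup V v)))) ⟩
      sum (λ v → 𝟙 (lookup U u) * (A u v * 1))                ≡⟨ sum-cong-≗ (λ v → cong (𝟙 (lookup U u) *_) (*-identityʳ (A u v))) ⟩
      sum (λ v → 𝟙 (lookup U u) * A u v)                      ≡⟨ *-distribˡ-sum (𝟙 (lookup U u)) (A u) ⟨
      𝟙 (lookup U u) * sum (A u)                              ≡⟨ cong (𝟙 (lookup U u) *_) (degree≡ u) ⟨
      𝟙 (lookup U u) * degree u                               ≤⟨ *-monoʳ-≤ (𝟙 (lookup U u)) (degree≤Δ u) ⟩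
      𝟙 (lookup U u) * Δ                                      ≡⟨ *-comm _ Δ ⟩
      Δ * 𝟙 (lookup U u)                                      ∎

  δ*∣X∣≤edges : δ * ∣ X ∣ ≤ edges
  δ*∣X∣≤edges = begin
    δ * ∣ X ∣                       ≡⟨ cong (δ *_) (∣∣≡size X) ⟩
    δ * sum x                       ≡⟨ *-distribˡ-sum δ x ⟩
    sum (λ u → δ * x u)             ≤⟨ sum-mono-≤ (λ u → *-monoˡ-≤ (x u) (δ≤degree u)) ⟩
    sum (λ u → degree u * x u)      ≡⟨ sum-cong-≗ (λ u → *-comm (degree u) (x u)) ⟩
    sum (λ u → x u * degree u)      ≡⟨ trans (sym (sum-elements X degree)) sum-degrees-X ⟩
    edges                           ∎

-- The centred adjacency matrix of the graph

module SpectralGap {c ℓ₁ ℓ₂} (ℝ : RealNumbers c ℓ₁ ℓ₂) (G : ConnectedBipartiteGraph) where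
  open import Data.Fin.Subset using (∣_∣)
  open RealNumbers ℝ hiding (zero)
  open OrderedFieldProperties ℝ hiding (∣_∣)
  open BilinearForms ℝ
  open Logarithm ℝ
  open ConnectedBipartiteGraph G
  open Counting G
  open Eigenvalues ℝ {n}
  open Invariants ℝ G
  open CourantFischer ℝ {n}
  open ≤-Reasoning

  xᶠ yᶠ : Fin n → Carrier
  xᶠ = fromℕ ∘ x
  yᶠ = fromℕ ∘ y

  Aᶠ : Matrix
  Aᶠ u v = fromℕ (A u v)

  K p : Carrier
  K = fromℕ Δ + d̄ + c̄
  p = c̄ /ℕ ∣ X ∣

  E : Matrix
  E u v = xᶠ u * yᶠ v * (Aᶠ u v - p)

  average-nonneg : ∀ m k → .{{_ : NonZero k}} → 0# ≤ fromℕ m /ℕ k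
  average-nonneg m k = /-nonneg (fromℕ-nonneg m) (fromℕ-pos k)

  0≤d̄ : 0# ≤ d̄
  0≤d̄ = average-nonneg (sumˡ (degrees X)) ∣ X ∣

  0≤c̄ : 0# ≤ c̄
  0≤c̄ = average-nonneg (sumˡ (degrees Y)) ∣ Y ∣

  Δ≤K : fromℕ Δ ≤ K
  Δ≤K = ≤-trans (x≤x+y (fromℕ Δ) 0≤d̄) (x≤x+y _ 0≤c̄)

  d̄≤K : d̄ ≤ K
  d̄≤K = ≤-trans (x≤y+x d̄ (fromℕ-nonneg Δ)) (x≤x+y _ 0≤c̄)

  c̄≤K : c̄ ≤ K
  c̄≤K = x≤y+x c̄ (+-nonneg (fromℕ-nonneg Δ) 0≤d̄)

  δ≤d̄ : fromℕ δ ≤ d̄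
  δ≤d̄ = ≤/ (fromℕ-pos ∣ X ∣) (begin
    fromℕ δ * fromℕ ∣ X ∣     ≈⟨ fromℕ-* δ ∣ X ∣ ⟨
    fromℕ (δ ℕ.* ∣ X ∣)       ≤⟨ fromℕ-mono-≤ δ*∣X∣≤edges ⟩
    fromℕ edges               ≡⟨ ≡.cong fromℕ sum-degrees-X ⟨
    fromℕ (sumˡ (degrees X))   ∎)

  0≤p : 0# ≤ p
  0≤p = /-nonneg 0≤c̄ (fromℕ-pos ∣ X ∣)

  p*∣X∣≈c̄ : p * fromℕ ∣ X ∣ ≈ c̄
  p*∣X∣≈c̄ = /-*-cancel c̄ (fromℕ-pos ∣ X ∣)

  -- By double counting, the density c̄/|X| is also d̄/|Y|; this gives the constant matrix its row
  -- sums d̄ beside its column sums c̄.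
  p*∣Y∣≈d̄ : p * fromℕ ∣ Y ∣ ≈ d̄
  p*∣Y∣≈d̄ = begin-equality
    c̄ * ∣X∣⁻¹ * fromℕ ∣ Y ∣               ≈⟨ solve 3 (λ c i y → c :* i :* y := c :* y :* i) refl c̄ ∣X∣⁻¹ (fromℕ ∣ Y ∣) ⟩
    c̄ * fromℕ ∣ Y ∣ * ∣X∣⁻¹               ≈⟨ *-congʳ (/-*-cancel (fromℕ (sumˡ (degrees Y))) (fromℕ-pos ∣ Y ∣)) ⟩
    fromℕ (sumˡ (degrees Y)) * ∣X∣⁻¹       ≡⟨ ≡.cong (λ m → fromℕ m * ∣X∣⁻¹) (≡.trans sum-degrees-Y (≡.sym sum-degrees-X)) ⟩
    fromℕ (sumˡ (degrees X)) * ∣X∣⁻¹       ∎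
    where
    ∣X∣⁻¹ : Carrier
    ∣X∣⁻¹ = proj₁ (inverse (fromℕ ∣ X ∣) (fromℕ-pos ∣ X ∣))

  expected : Subset n → Subset n → Carrier
  expected U V = (fromℕ ∣ U ∣ * fromℕ ∣ V ∣ * c̄) /ℕ ∣ X ∣

  expected≈ : ∀ U V → expected U V ≈ p * (fromℕ ∣ U ∣ * fromℕ ∣ V ∣)
  expected≈ U V = solve 4 (λ u v c i → u :* v :* c :* i := c :* i :* (u :* v)) refl
    (fromℕ ∣ U ∣) (fromℕ ∣ V ∣) c̄ (proj₁ (inverse (fromℕ ∣ X ∣) (fromℕ-pos ∣ X ∣)))

  fromℕ-∣∣ : ∀ (U : Subset n) → fromℕ ∣ U ∣ ≈ ∑ (λ u → fromℕ (𝟙 (lookup U u)))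
  fromℕ-∣∣ U = trans (reflexive (≡.cong fromℕ (∣∣≡size U))) (fromℕ-∑ (𝟙 ∘ lookup U))

  -- `E` vanishes outside X × Y, so the form sees only the traces of the two sets on the parts.
  form-E-indicators : ∀ U V → let U′ = restrict U X ; V′ = restrict V Y in
    form E (fromℕ ∘ 𝟙 ∘ U) (fromℕ ∘ 𝟙 ∘ V) ≈ fromℕ (e U′ V′) - expected U′ V′
  form-E-indicators U V = begin-equality
    form E (fromℕ ∘ 𝟙 ∘ U) (fromℕ ∘ 𝟙 ∘ V)
      ≈⟨ ∑∑-cong entry ⟩
    ∑ (λ u → ∑ λ v → fromℕ (𝟙U′ u ℕ.* (A u v ℕ.* 𝟙V′ v)) + - p * (fromℕ (𝟙U′ u) * fromℕ (𝟙V′ v)))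
      ≈⟨ ∑∑-distrib-+ (λ u v → fromℕ (𝟙U′ u ℕ.* (A u v ℕ.* 𝟙V′ v))) _ ⟩
    ∑ (λ u → ∑ λ v → fromℕ (𝟙U′ u ℕ.* (A u v ℕ.* 𝟙V′ v))) + ∑ (λ u → ∑ λ v → - p * (fromℕ (𝟙U′ u) * fromℕ (𝟙V′ v)))
      ≈⟨ +-cong (trans (reflexive (≡.cong fromℕ (e≡ U′ V′)))
                  (trans (fromℕ-∑ λ u → ℕ-Sum.sum λ v → 𝟙U′ u ℕ.* (A u v ℕ.* 𝟙V′ v))
                         (∑-cong λ u → fromℕ-∑ λ v → 𝟙U′ u ℕ.* (A u v ℕ.* 𝟙V′ v))))
                (trans (*-congˡ (trans (*-cong (fromℕ-∣∣ U′) (fromℕ-∣∣ V′)) (∑-*-∑ (fromℕ ∘ 𝟙U′) (fromℕ ∘ 𝟙V′))))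
                       (*-distribˡ-∑∑ (- p) λ u v → fromℕ (𝟙U′ u) * fromℕ (𝟙V′ v))) ⟨
    fromℕ (e U′ V′) + - p * (fromℕ ∣ U′ ∣ * fromℕ ∣ V′ ∣)
      ≈⟨ +-congˡ (solve 2 (λ p a → (:- p) :* a := :- (p :* a)) refl p (fromℕ ∣ U′ ∣ * fromℕ ∣ V′ ∣)) ⟩
    fromℕ (e U′ V′) - p * (fromℕ ∣ U′ ∣ * fromℕ ∣ V′ ∣)
      ≈⟨ +-congˡ (-‿cong (expected≈ U′ V′)) ⟨
    fromℕ (e U′ V′) - expected U′ V′ ∎
    where
    U′ V′ : Subset n
    U′ = restrict U X
    V′ = restrict V Y
    𝟙U′ 𝟙V′ : Fin n → ℕ
    𝟙U′ = 𝟙 ∘ lookup U′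
    𝟙V′ = 𝟙 ∘ lookup V′
    𝟙U′≈ : ∀ u → fromℕ (𝟙U′ u) ≈ fromℕ (𝟙 (U u)) * xᶠ u
    𝟙U′≈ u = trans (reflexive (≡.cong fromℕ (𝟙-restrict U X u))) (fromℕ-* (𝟙 (U u)) (x u))
    𝟙V′≈ : ∀ v → fromℕ (𝟙V′ v) ≈ fromℕ (𝟙 (V v)) * yᶠ v
    𝟙V′≈ v = trans (reflexive (≡.cong fromℕ (𝟙-restrict V Y v))) (fromℕ-* (𝟙 (V v)) (y v))
    entry : ∀ u v → E u v * (fromℕ (𝟙 (U u)) * fromℕ (𝟙 (V v))) ≈
      fromℕ (𝟙U′ u ℕ.* (A u v ℕ.* 𝟙V′ v)) + - p * (fromℕ (𝟙U′ u) * fromℕ (𝟙V′ v))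
    entry u v = begin-equality
      E u v * (fromℕ (𝟙 (U u)) * fromℕ (𝟙 (V v)))
        ≈⟨ solve 6 (λ x y a p U V → x :* y :* (a :- p) :* (U :* V)
             := (U :* x) :* (a :* (V :* y)) :+ (:- p) :* ((U :* x) :* (V :* y)))
             refl (xᶠ u) (yᶠ v) (Aᶠ u v) p (fromℕ (𝟙 (U u))) (fromℕ (𝟙 (V v))) ⟩
      (fromℕ (𝟙 (U u)) * xᶠ u) * (Aᶠ u v * (fromℕ (𝟙 (V v)) * yᶠ v))
        + - p * ((fromℕ (𝟙 (U u)) * xᶠ u) * (fromℕ (𝟙 (V v)) * yᶠ v))
        ≈⟨ +-cong (*-cong (𝟙U′≈ u) (*-congˡ (𝟙V′≈ v))) (*-congˡ (*-cong (𝟙U′≈ u) (𝟙V′≈ v))) ⟨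
      fromℕ (𝟙U′ u) * (Aᶠ u v * fromℕ (𝟙V′ v)) + - p * (fromℕ (𝟙U′ u) * fromℕ (𝟙V′ v))
        ≈⟨ +-congʳ (trans (fromℕ-* (𝟙U′ u) _) (*-congˡ (fromℕ-* (A u v) (𝟙V′ v)))) ⟨
      fromℕ (𝟙U′ u ℕ.* (A u v ℕ.* 𝟙V′ v)) + - p * (fromℕ (𝟙U′ u) * fromℕ (𝟙V′ v)) ∎

  -- With A = i²a and B = j²b the left side is √(AB), and AB ≤ (A + B)² because each factor is at
  -- most the sum.
  scaled-√≤ : ∀ i j a b → fromℕ (i ℕ.* j) * √ (fromℕ a * fromℕ b) ≤ fromℕ (i ℕ.* i ℕ.* a ℕ.+ j ℕ.* j ℕ.* b)
  scaled-√≤ i j a b = x*x≤y*y⇒x≤y (fromℕ-nonneg s) (begin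
    (fromℕ (i ℕ.* j) * r) * (fromℕ (i ℕ.* j) * r)
      ≈⟨ *-cong (*-congʳ (fromℕ-* i j)) (*-congʳ (fromℕ-* i j)) ⟩
    (fromℕ i * fromℕ j * r) * (fromℕ i * fromℕ j * r)
      ≈⟨ solve 3 (λ i j r → (i :* j :* r) :* (i :* j :* r) := i :* i :* (j :* j) :* (r :* r)) refl (fromℕ i) (fromℕ j) r ⟩
    fromℕ i * fromℕ i * (fromℕ j * fromℕ j) * (r * r)
      ≈⟨ *-congˡ (√-square (*-nonneg (fromℕ-nonneg a) (fromℕ-nonneg b))) ⟩
    fromℕ i * fromℕ i * (fromℕ j * fromℕ j) * (fromℕ a * fromℕ b)
      ≈⟨ solve 4 (λ i j a b → i :* i :* (j :* j) :* (a :* b) := (i :* i :* a) :* (j :* j :* b))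
           refl (fromℕ i) (fromℕ j) (fromℕ a) (fromℕ b) ⟩
    (fromℕ i * fromℕ i * fromℕ a) * (fromℕ j * fromℕ j * fromℕ b)
      ≈⟨ trans (fromℕ-* (i ℕ.* i ℕ.* a) _) (*-cong (iia i a) (iia j b)) ⟨
    fromℕ ((i ℕ.* i ℕ.* a) ℕ.* (j ℕ.* j ℕ.* b))
      ≤⟨ fromℕ-mono-≤ (ℕ.*-mono-≤ (ℕ.m≤m+n (i ℕ.* i ℕ.* a) _) (ℕ.m≤n+m (j ℕ.* j ℕ.* b) _)) ⟩
    fromℕ (s ℕ.* s)
      ≈⟨ fromℕ-* s s ⟩
    fromℕ s * fromℕ s ∎)
    where
    r : Carrier
    r = √ (fromℕ a * fromℕ b)
    s : ℕ
    s = i ℕ.* i ℕ.* a ℕ.+ j ℕ.* j ℕ.* b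
    iia : ∀ i a → fromℕ (i ℕ.* i ℕ.* a) ≈ fromℕ i * fromℕ i * fromℕ a
    iia i a = trans (fromℕ-* (i ℕ.* i) a) (*-congʳ (fromℕ-* i i))

  -- Discrepancy of the centred matrix

  module _ (ϵ : Carrier) (0<ϵ : 0# < ϵ) (disc : Discrepancy≤ ϵ) where

    private
      0≤ϵ : 0# ≤ ϵ
      0≤ϵ = <⇒≤ 0<ϵ

    module _ (L : ℕ) (K≤ : K ≤ ϵ * fromℕ (2 ℕ.^ L)) (U V : Fin n → Bool) where

      private
        U′ V′ : Subset n
        U′ = restrict U X
        V′ = restrict V Y
        u v : ℕ
        u = ∣ U′ ∣
        v = ∣ V′ ∣

        bounded⇒Discrepancy : ∀ {q q′} → q ≈ q′ → q′ ≤ ϵ * √ (fromℕ u * fromℕ v) →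
          q′ ≤ K * fromℕ u → q′ ≤ K * fromℕ v → Discrepancy ϵ 0≤ϵ L q (size U) (size V)
        bounded⇒Discrepancy {q} {q′} q≈q′ mixed left right = record
          { mixed = λ i j → begin
              fromℕ (i ℕ.* j) * q
                ≤⟨ *-monoˡ-≤ (fromℕ-nonneg (i ℕ.* j)) (≤-trans (≤-reflexive q≈q′) mixed) ⟩
              fromℕ (i ℕ.* j) * (ϵ * √ (fromℕ u * fromℕ v))
                ≈⟨ solve 3 (λ m ϵ r → m :* (ϵ :* r) := ϵ :* (m :* r)) refl (fromℕ (i ℕ.* j)) ϵ (√ (fromℕ u * fromℕ v)) ⟩
              ϵ * (fromℕ (i ℕ.* j) * √ (fromℕ u * fromℕ v))
                ≤⟨ *-monoˡ-≤ 0≤ϵ (scaled-√≤ i j u v) ⟩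
              ϵ * fromℕ (i ℕ.* i ℕ.* u ℕ.+ j ℕ.* j ℕ.* v)
                ≤⟨ *-monoˡ-≤ 0≤ϵ (fromℕ-mono-≤ (ℕ.+-mono-≤ (ℕ.*-monoʳ-≤ (i ℕ.* i) (∣restrict∣≤size U X))
                                                            (ℕ.*-monoʳ-≤ (j ℕ.* j) (∣restrict∣≤size V Y)))) ⟩
              ϵ * fromℕ (i ℕ.* i ℕ.* size U ℕ.+ j ℕ.* j ℕ.* size V) ∎
          ; left  = one-sided u (size U) (∣restrict∣≤size U X) left
          ; right = one-sided v (size V) (∣restrict∣≤size V Y) right
          }
          where
          one-sided : ∀ k l → k ℕ.≤ l → q′ ≤ K * fromℕ k → q ≤ ϵ * fromℕ (2 ℕ.^ L ℕ.* l)
          one-sided k l k≤l q′≤ = begin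
            q                                   ≈⟨ q≈q′ ⟩
            q′                                  ≤⟨ q′≤ ⟩
            K * fromℕ k                         ≤⟨ *-mono-≤ (*-nonneg 0≤ϵ (fromℕ-nonneg (2 ℕ.^ L))) (fromℕ-nonneg k) K≤ (fromℕ-mono-≤ k≤l) ⟩
            ϵ * fromℕ (2 ℕ.^ L) * fromℕ l       ≈⟨ *-assoc _ _ _ ⟩
            ϵ * (fromℕ (2 ℕ.^ L) * fromℕ l)     ≈⟨ *-congˡ (fromℕ-* (2 ℕ.^ L) l) ⟨
            ϵ * fromℕ (2 ℕ.^ L ℕ.* l)           ∎

        0≤expected : 0# ≤ expected U′ V′
        0≤expected = ≤-trans (*-nonneg 0≤p (*-nonneg (fromℕ-nonneg u) (fromℕ-nonneg v))) (≤-reflexive (sym (expected≈ U′ V′)))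

        e≤K*u : fromℕ (e U′ V′) ≤ K * fromℕ u
        e≤K*u = begin
          fromℕ (e U′ V′)       ≤⟨ fromℕ-mono-≤ (e≤Δ*∣∣ U′ V′) ⟩
          fromℕ (Δ ℕ.* u)       ≈⟨ fromℕ-* Δ u ⟩
          fromℕ Δ * fromℕ u     ≤⟨ *-monoʳ-≤ (fromℕ-nonneg u) Δ≤K ⟩
          K * fromℕ u           ∎

        e≤K*v : fromℕ (e U′ V′) ≤ K * fromℕ v
        e≤K*v = begin
          fromℕ (e U′ V′)       ≤⟨ fromℕ-mono-≤ (ℕ.≤-trans (ℕ.≤-reflexive (e-sym U′ V′)) (e≤Δ*∣∣ V′ U′)) ⟩
          fromℕ (Δ ℕ.* v)       ≈⟨ fromℕ-* Δ v ⟩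
          fromℕ Δ * fromℕ v     ≤⟨ *-monoʳ-≤ (fromℕ-nonneg v) Δ≤K ⟩
          K * fromℕ v           ∎

        expected≤K*u : expected U′ V′ ≤ K * fromℕ u
        expected≤K*u = begin
          expected U′ V′                   ≈⟨ expected≈ U′ V′ ⟩
          p * (fromℕ u * fromℕ v)          ≈⟨ solve 3 (λ p u v → p :* (u :* v) := p :* v :* u) refl p (fromℕ u) (fromℕ v) ⟩
          p * fromℕ v * fromℕ u            ≤⟨ *-monoʳ-≤ (fromℕ-nonneg u) (*-monoˡ-≤ 0≤p (fromℕ-mono-≤ (p⊆q⇒∣p∣≤∣q∣ (restrict⊆ V Y)))) ⟩
          p * fromℕ ∣ Y ∣ * fromℕ u        ≈⟨ *-congʳ p*∣Y∣≈d̄ ⟩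
          d̄ * fromℕ u                      ≤⟨ *-monoʳ-≤ (fromℕ-nonneg u) d̄≤K ⟩
          K * fromℕ u                      ∎

        expected≤K*v : expected U′ V′ ≤ K * fromℕ v
        expected≤K*v = begin
          expected U′ V′                   ≈⟨ expected≈ U′ V′ ⟩
          p * (fromℕ u * fromℕ v)          ≈⟨ *-assoc _ _ _ ⟨
          p * fromℕ u * fromℕ v            ≤⟨ *-monoʳ-≤ (fromℕ-nonneg v) (*-monoˡ-≤ 0≤p (fromℕ-mono-≤ (p⊆q⇒∣p∣≤∣q∣ (restrict⊆ U X)))) ⟩
          p * fromℕ ∣ X ∣ * fromℕ v        ≈⟨ *-congʳ p*∣X∣≈c̄ ⟩
          c̄ * fromℕ v                      ≤⟨ *-monoʳ-≤ (fromℕ-nonneg v) c̄≤K ⟩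
          K * fromℕ v                      ∎

        -[e-expected]≤expected : - (fromℕ (e U′ V′) - expected U′ V′) ≤ expected U′ V′
        -[e-expected]≤expected = ≤-trans
          (≤-reflexive (solve 2 (λ e t → :- (e :- t) := t :- e) refl (fromℕ (e U′ V′)) (expected U′ V′)))
          (x-y≤x (expected U′ V′) (fromℕ-nonneg (e U′ V′)))

        e-expected≤e : fromℕ (e U′ V′) - expected U′ V′ ≤ fromℕ (e U′ V′)
        e-expected≤e = x-y≤x (fromℕ (e U′ V′)) 0≤expected

      E-discrepancy : Discrepancy ϵ 0≤ϵ L (form E (fromℕ ∘ 𝟙 ∘ U) (fromℕ ∘ 𝟙 ∘ V)) (size U) (size V)
      E-discrepancy = bounded⇒Discrepancy (form-E-indicators U V)
        (proj₁ (disc U′ V′ (restrict⊆ U X) (restrict⊆ V Y)))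
        (≤-trans e-expected≤e e≤K*u) (≤-trans e-expected≤e e≤K*v)

      -- Here the trivial bounds come from the expected count rather than from the edges: it is at
      -- most d̄|U| and at most c̄|V|. This is why K contains both averages beside Δ.
      -E-discrepancy : Discrepancy ϵ 0≤ϵ L (form (λ u v → - E u v) (fromℕ ∘ 𝟙 ∘ U) (fromℕ ∘ 𝟙 ∘ V)) (size U) (size V)
      -E-discrepancy = bounded⇒Discrepancy
        (trans (form-neg E (fromℕ ∘ 𝟙 ∘ U) (fromℕ ∘ 𝟙 ∘ V)) (-‿cong (form-E-indicators U V)))
        (proj₂ (disc U′ V′ (restrict⊆ U X) (restrict⊆ V Y)))
        (≤-trans -[e-expected]≤expected expected≤K*u) (≤-trans -[e-expected]≤expected expected≤K*v)

  -- Quadratic forms and the normalized Laplacian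

  degreeNorm : Vector → Carrier
  degreeNorm h = ∑ λ u → fromℕ (degree u) * (h u * h u)

  fromℕ-degree : ∀ u → fromℕ (degree u) ≈ ∑ (Aᶠ u)
  fromℕ-degree u = trans (reflexive (≡.cong fromℕ (degree≡ u))) (fromℕ-∑ (A u))

  Aᶠ-sym : ∀ u v → Aᶠ u v ≈ Aᶠ v u
  Aᶠ-sym u v = reflexive (≡.cong fromℕ (A-sym u v))

  degreeNorm≈ : ∀ h → ∑ (λ u → ∑ λ v → Aᶠ u v * (h u * h u)) ≈ degreeNorm h
  degreeNorm≈ h = ∑-cong λ u → trans (sym (*-distribʳ-sum (h u * h u) (Aᶠ u))) (*-congʳ (sym (fromℕ-degree u)))

  -- Positivity of D - A: each edge contributes 2h(u)h(v) ≤ h(u)² + h(v)².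
  form-A≤degreeNorm : ∀ h → form Aᶠ h h ≤ degreeNorm h
  form-A≤degreeNorm h = *-cancelˡ-≤ (fromℕ-pos 2) (begin
    fromℕ 2 * form Aᶠ h h
      ≈⟨ *-distribˡ-∑∑ (fromℕ 2) (λ u v → Aᶠ u v * (h u * h v)) ⟩
    ∑ (λ u → ∑ λ v → fromℕ 2 * (Aᶠ u v * (h u * h v)))
      ≤⟨ ∑∑-mono-≤ entry ⟩
    ∑ (λ u → ∑ λ v → Aᶠ u v * (h u * h u) + Aᶠ u v * (h v * h v))
      ≈⟨ ∑∑-distrib-+ (λ u v → Aᶠ u v * (h u * h u)) (λ u v → Aᶠ u v * (h v * h v)) ⟩
    ∑ (λ u → ∑ λ v → Aᶠ u v * (h u * h u)) + ∑ (λ u → ∑ λ v → Aᶠ u v * (h v * h v))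
      ≈⟨ +-cong (degreeNorm≈ h) (trans (∑-comm λ u v → Aᶠ u v * (h v * h v))
           (trans (∑∑-cong λ v u → *-congʳ (Aᶠ-sym u v)) (degreeNorm≈ h))) ⟩
    degreeNorm h + degreeNorm h
      ≈⟨ solve 1 (λ d → d :+ d := (con (+ 1) :+ (con (+ 1) :+ con (+ 0))) :* d) refl (degreeNorm h) ⟩
    fromℕ 2 * degreeNorm h ∎)
    where
    entry : ∀ u v → fromℕ 2 * (Aᶠ u v * (h u * h v)) ≤ Aᶠ u v * (h u * h u) + Aᶠ u v * (h v * h v)
    entry u v = begin
      fromℕ 2 * (Aᶠ u v * (h u * h v))
        ≈⟨ solve 2 (λ a t → (con (+ 1) :+ (con (+ 1) :+ con (+ 0))) :* (a :* t) := a :* (t :+ t)) refl (Aᶠ u v) (h u * h v) ⟩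
      Aᶠ u v * (h u * h v + h u * h v)
        ≤⟨ *-monoˡ-≤ (fromℕ-nonneg (A u v)) (2xy≤xx+yy (h u) (h v)) ⟩
      Aᶠ u v * (h u * h u + h v * h v)
        ≈⟨ distribˡ (Aᶠ u v) _ _ ⟩
      Aᶠ u v * (h u * h u) + Aᶠ u v * (h v * h v) ∎

  -- On one block the constant `p` contributes p times the product of the sums of h over X and over
  -- Y. One vanishing factor is enough, and the other block is the transpose, so a single linear
  -- condition on h serves both.
  form-A≈2*form-E : ∀ h → ∑ (λ v → yᶠ v * h v) ≈ 0# → form Aᶠ h h ≈ form E h h + form E h h
  form-A≈2*form-E h ∑yh≈0 = begin-equality
    form Aᶠ h h
      ≈⟨ ∑∑-cong split ⟩
    ∑ (λ u → ∑ λ v → xAy u v + xAy v u)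
      ≈⟨ ∑∑-distrib-+ xAy (λ u v → xAy v u) ⟩
    ∑ (λ u → ∑ (xAy u)) + ∑ (λ u → ∑ λ v → xAy v u)
      ≈⟨ +-congˡ (∑-comm λ u v → xAy v u) ⟩
    ∑ (λ u → ∑ (xAy u)) + ∑ (λ u → ∑ (xAy u))
      ≈⟨ +-cong ∑xAy≈ ∑xAy≈ ⟩
    form E h h + form E h h ∎
    where
    xAy : Matrix
    xAy u v = xᶠ u * (Aᶠ u v * yᶠ v) * (h u * h v)

    split : ∀ u v → Aᶠ u v * (h u * h v) ≈ xAy u v + xAy v u
    split u v = begin-equality
      Aᶠ u v * (h u * h v)
        ≡⟨ ≡.cong (λ a → fromℕ a * (h u * h v)) (A-split u v) ⟩
      fromℕ (x u ℕ.* (A u v ℕ.* y v) ℕ.+ y u ℕ.* (A u v ℕ.* x v)) * (h u * h v)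
        ≈⟨ *-congʳ (trans (fromℕ-+ (x u ℕ.* (A u v ℕ.* y v)) _) (+-cong (triple (x u) (A u v) (y v)) (triple (y u) (A u v) (x v)))) ⟩
      (xᶠ u * (Aᶠ u v * yᶠ v) + yᶠ u * (Aᶠ u v * xᶠ v)) * (h u * h v)
        ≈⟨ *-congʳ (+-congˡ (*-congˡ (*-congʳ (Aᶠ-sym u v)))) ⟩
      (xᶠ u * (Aᶠ u v * yᶠ v) + yᶠ u * (Aᶠ v u * xᶠ v)) * (h u * h v)
        ≈⟨ solve 6 (λ t y a x h h′ → (t :+ y :* (a :* x)) :* (h :* h′) := t :* (h :* h′) :+ x :* (a :* y) :* (h′ :* h))
             refl (xᶠ u * (Aᶠ u v * yᶠ v)) (yᶠ u) (Aᶠ v u) (xᶠ v) (h u) (h v) ⟩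
      xAy u v + xAy v u ∎
      where
      triple : ∀ i j k → fromℕ (i ℕ.* (j ℕ.* k)) ≈ fromℕ i * (fromℕ j * fromℕ k)
      triple i j k = trans (fromℕ-* i _) (*-congˡ (fromℕ-* j k))

    ∑xAy≈ : ∑ (λ u → ∑ (xAy u)) ≈ form E h h
    ∑xAy≈ = begin-equality
      ∑ (λ u → ∑ (xAy u))
        ≈⟨ ∑∑-cong (λ u v → solve 6 (λ x y a p h h′ → x :* (a :* y) :* (h :* h′)
             := x :* y :* (a :- p) :* (h :* h′) :+ p :* ((x :* h) :* (y :* h′)))
             refl (xᶠ u) (yᶠ v) (Aᶠ u v) p (h u) (h v)) ⟩
      ∑ (λ u → ∑ λ v → E u v * (h u * h v) + p * ((xᶠ u * h u) * (yᶠ v * h v)))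
        ≈⟨ ∑∑-distrib-+ (λ u v → E u v * (h u * h v)) (λ u v → p * ((xᶠ u * h u) * (yᶠ v * h v))) ⟩
      form E h h + ∑ (λ u → ∑ λ v → p * ((xᶠ u * h u) * (yᶠ v * h v)))
        ≈⟨ +-congˡ (trans (sym (*-distribˡ-∑∑ p λ u v → (xᶠ u * h u) * (yᶠ v * h v)))
             (*-congˡ (sym (∑-*-∑ (λ u → xᶠ u * h u) (λ v → yᶠ v * h v))))) ⟩
      form E h h + p * (∑ (λ u → xᶠ u * h u) * ∑ (λ v → yᶠ v * h v))
        ≈⟨ +-congˡ (*-congˡ (*-congˡ ∑yh≈0)) ⟩
      form E h h + p * (∑ (λ u → xᶠ u * h u) * 0#)
        ≈⟨ solve 3 (λ q p x → q :+ p :* (x :* con (+ 0)) := q) refl (form E h h) p (∑ (λ u → xᶠ u * h u)) ⟩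
      form E h h ∎

  -- The diagonal of D^(-1/2). Substituting h = D^(-1/2) w turns |w|² into `degreeNorm h` and the
  -- Rayleigh quotient of the Laplacian into one minus that of A relative to D.
  s : Vector
  s u = √ (1# /ℕ degree u)

  degree*s*s≈1 : ∀ u → fromℕ (degree u) * (s u * s u) ≈ 1#
  degree*s*s≈1 u = begin-equality
    fromℕ (degree u) * (s u * s u)         ≈⟨ *-congˡ (√-square (/-nonneg 0≤1 (fromℕ-pos (degree u)))) ⟩
    fromℕ (degree u) * (1# /ℕ degree u)    ≈⟨ *-comm _ _ ⟩
    (1# /ℕ degree u) * fromℕ (degree u)    ≈⟨ /-*-cancel 1# (fromℕ-pos (degree u)) ⟩
    1#                                     ∎

  degreeNorm-s : ∀ w → degreeNorm (λ u → s u * w u) ≈ w ∙ w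
  degreeNorm-s w = ∑-cong λ u → begin-equality
    fromℕ (degree u) * ((s u * w u) * (s u * w u))
      ≈⟨ solve 3 (λ d s w → d :* ((s :* w) :* (s :* w)) := d :* (s :* s) :* (w :* w)) refl (fromℕ (degree u)) (s u) (w u) ⟩
    fromℕ (degree u) * (s u * s u) * (w u * w u)
      ≈⟨ *-congʳ (degree*s*s≈1 u) ⟩
    1# * (w u * w u)
      ≈⟨ *-identityˡ _ ⟩
    w u * w u ∎

  adjacency≈Aᶠ : ∀ u v → adjacency u v ≈ Aᶠ u v
  adjacency≈Aᶠ u v with adj u v
  ... | true  = sym fromℕ-1
  ... | false = refl

  normalizedLaplacian-sym : ∀ u v → normalizedLaplacian u v ≈ normalizedLaplacian v u
  normalizedLaplacian-sym u v = +-cong (reflexive (identity-sym u v)) (-‿cong (begin-equality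
    s u * adjacency u v * s v   ≈⟨ *-congʳ (*-congˡ (reflexive (≡.cong (if_then 1# else 0#) (adj-sym u v)))) ⟩
    s u * adjacency v u * s v   ≈⟨ solve 3 (λ x a y → x :* a :* y := y :* a :* x) refl (s u) (adjacency v u) (s v) ⟩
    s v * adjacency v u * s u   ∎))
    where
    identity-sym : ∀ u v → identity u v ≡ identity v u
    identity-sym u v with u ≟ v | v ≟ u
    ... | yes _   | yes _   = ≡.refl
    ... | no  _   | no  _   = ≡.refl
    ... | yes u≡v | no  v≢u = contradiction (≡.sym u≡v) v≢u
    ... | no  u≢v | yes v≡u = contradiction (≡.sym v≡u) u≢v

  ∑-zero : ∀ m → ∑ {m} (λ _ → 0#) ≈ 0#
  ∑-zero zero    = refl
  ∑-zero (suc m) = trans (+-identityˡ _) (∑-zero m)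

  ∑-δ : ∀ {m} (u : Fin m) (w : Fin m → Carrier) → ∑ (λ v → (if does (u ≟ v) then 1# else 0#) * w v) ≈ w u
  ∑-δ {suc m} zero    w = trans (+-cong (*-identityˡ (w zero)) (trans (∑-cong λ v → zeroˡ (w (suc v))) (∑-zero m)))
                                (+-identityʳ (w zero))
  ∑-δ {suc m} (suc u) w = trans (+-cong (zeroˡ (w zero)) (∑-δ u (w ∘ suc))) (+-identityˡ (w (suc u)))

  Laplacian-form : ∀ w → let h = λ u → s u * w u in
    w ∙ (normalizedLaplacian $ w) ≈ w ∙ w - form Aᶠ h h
  Laplacian-form w = begin-equality
    w ∙ (normalizedLaplacian $ w)
      ≈⟨ ∑-cong (λ u → *-distribˡ-sum (w u) λ v → normalizedLaplacian u v * w v) ⟩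
    ∑ (λ u → ∑ λ v → w u * (normalizedLaplacian u v * w v))
      ≈⟨ ∑∑-cong entry ⟩
    ∑ (λ u → ∑ λ v → w u * (identity u v * w v) + - Aᶠ u v * (h u * h v))
      ≈⟨ ∑∑-distrib-+ (λ u v → w u * (identity u v * w v)) (λ u v → - Aᶠ u v * (h u * h v)) ⟩
    ∑ (λ u → ∑ λ v → w u * (identity u v * w v)) + form (λ u v → - Aᶠ u v) h h
      ≈⟨ +-cong (∑-cong λ u → trans (sym (*-distribˡ-sum (w u) λ v → identity u v * w v)) (*-congˡ (∑-δ u w)))
                (form-neg Aᶠ h h) ⟩
    w ∙ w - form Aᶠ h h ∎
    where
    h : Vector
    h u = s u * w u
    entry : ∀ u v → w u * (normalizedLaplacian u v * w v) ≈ w u * (identity u v * w v) + - Aᶠ u v * (h u * h v)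
    entry u v = trans (*-congˡ (*-congʳ (+-congˡ (-‿cong (*-congʳ (*-congˡ (adjacency≈Aᶠ u v)))))))
      (solve 6 (λ w w′ s s′ i a → w :* ((i :- s :* a :* s′) :* w′) := w :* (i :* w′) :+ (:- a) :* ((s :* w) :* (s′ :* w′)))
        refl (w u) (w v) (s u) (s v) (identity u v) (Aᶠ u v))

  -- The functional `yᶠ v * s v` is chosen so that orthogonality of w to it becomes, after the
  -- substitution h = D^(-1/2) w, the vanishing of the sum of h over Y.
  1-t≤gap : ∀ t → (∀ h → ∑ (λ v → yᶠ v * h v) ≈ 0# → form Aᶠ h h ≤ t * degreeNorm h) →
    ∀ λ₂ → IsSpectralGap λ₂ → 1# - t ≤ λ₂
  1-t≤gap t bound λ₂ ((_ , areTwo) , _) =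
    AreTwoEigenvalues⇒≥ normalizedLaplacian normalizedLaplacian-sym (λ v → yᶠ v * s v) (1# - t) Rayleigh areTwo
    where
    Rayleigh : ∀ w → (λ v → yᶠ v * s v) ∙ w ≈ 0# → (1# - t) * (w ∙ w) ≤ w ∙ (normalizedLaplacian $ w)
    Rayleigh w orthogonal = begin
      (1# - t) * (w ∙ w)              ≈⟨ solve 2 (λ t x → (con (+ 1) :- t) :* x := x :- t :* x) refl t (w ∙ w) ⟩
      w ∙ w - t * (w ∙ w)             ≈⟨ +-congˡ (-‿cong (*-congˡ (degreeNorm-s w))) ⟨
      w ∙ w - t * degreeNorm h        ≤⟨ +-monoʳ-≤ (w ∙ w) (-‿antimono-≤ (bound h
                                           (trans (∑-cong λ v → sym (*-assoc (yᶠ v) (s v) (w v))) orthogonal))) ⟩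
      w ∙ w - form Aᶠ h h             ≈⟨ Laplacian-form w ⟨
      w ∙ (normalizedLaplacian $ w)   ∎
      where
      h : Vector
      h u = s u * w u

  deviation-nonneg : ∀ S → .{{_ : NonZero ∣ S ∣}} → 0# ≤ degreeDeviation S
  deviation-nonneg S = √-nonneg (/-nonneg (squares (λ u → fromℕ (degree u) - averageDegree S) (elements S)) (fromℕ-pos ∣ S ∣))
    where
    squares : ∀ (f : Vector) us → 0# ≤ foldr _+_ 0# (map (λ u → f u * f u) us)
    squares f []       = ≤-refl
    squares f (u ∷ us) = +-nonneg (x*x-nonneg (f u)) (squares f us)

  -- The two ranges of K / ϵ

  module _ (C : Carrier) (80≤C : fromℕ 8 * fromℕ 10 ≤ C)
           (ϵ : Carrier) (0<ϵ : 0# < ϵ) (ϵ≤Δ : ϵ ≤ fromℕ Δ) (disc : Discrepancy≤ ϵ) where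

    private
      R l t : Carrier
      R = K / ϵ ∵ 0<ϵ
      l = logRatio ϵ 0<ϵ
      t = (C * ϵ * l + C) /ℕ δ

      4≤C : fromℕ 4 ≤ C
      4≤C = begin
        fromℕ 4               ≤⟨ fromℕ-mono-≤ (ℕ.m≤m+n 4 4) ⟩
        fromℕ 8               ≈⟨ *-identityʳ (fromℕ 8) ⟨
        fromℕ 8 * 1#          ≤⟨ *-monoˡ-≤ (fromℕ-nonneg 8) (x≤x+y 1# (fromℕ-nonneg 9)) ⟩
        fromℕ 8 * fromℕ 10    ≤⟨ 80≤C ⟩
        C                     ∎

      0≤C : 0# ≤ C
      0≤C = ≤-trans (fromℕ-nonneg 4) 4≤C

      0≤ϵ : 0# ≤ ϵ
      0≤ϵ = <⇒≤ 0<ϵ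

      ϵ*R≈K : ϵ * R ≈ K
      ϵ*R≈K = trans (*-comm ϵ R) (/-*-cancel K 0<ϵ)

      1≤R : 1# ≤ R
      1≤R = ≤/ 0<ϵ (≤-trans (≤-reflexive (*-identityˡ ϵ)) (≤-trans ϵ≤Δ Δ≤K))

      0≤l : 0# ≤ l
      0≤l = log-nonneg _ 1≤R

      t*δ≈ : t * fromℕ δ ≈ C * ϵ * l + C
      t*δ≈ = /-*-cancel (C * ϵ * l + C) (fromℕ-pos δ)

      0≤t : 0# ≤ t
      0≤t = /-nonneg (+-nonneg (*-nonneg (*-nonneg 0≤C 0≤ϵ) 0≤l) 0≤C) (fromℕ-pos δ)

      degreeNorm-nonneg : ∀ h → 0# ≤ degreeNorm h
      degreeNorm-nonneg h = ∑-nonneg λ u → *-nonneg (fromℕ-nonneg (degree u)) (x*x-nonneg (h u))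

      -- For R near 1 the logarithm is near 0, so K itself cannot be compared with ϵ log R. But ϵ ≤
      -- Δ gives d̄ ≤ K - ϵ = ϵ(R - 1), and R - 1 ≤ R log R ≤ 4 log R. It follows that t ≥ 1, where
      -- positivity of D - A suffices.
      δ≤Cϵl+C : R ≤ fromℕ 4 → fromℕ δ ≤ C * ϵ * l + C
      δ≤Cϵl+C R≤4 = begin
        fromℕ δ                   ≤⟨ δ≤d̄ ⟩
        d̄                         ≈⟨ solve 2 (λ d ϵ → d := (ϵ :+ d) :- ϵ) refl d̄ ϵ ⟩
        (ϵ + d̄) - ϵ               ≤⟨ +-monoˡ-≤ (- ϵ) (≤-trans (+-monoˡ-≤ d̄ ϵ≤Δ) (x≤x+y _ 0≤c̄)) ⟩
        K - ϵ                     ≈⟨ +-congʳ ϵ*R≈K ⟨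
        ϵ * R - ϵ                 ≈⟨ solve 2 (λ ϵ r → ϵ :* r :- ϵ := ϵ :* (r :- con (+ 1))) refl ϵ R ⟩
        ϵ * (R - 1#)              ≤⟨ *-monoˡ-≤ 0≤ϵ (x-1≤x*log _) ⟩
        ϵ * (R * l)               ≤⟨ *-monoˡ-≤ 0≤ϵ (*-monoʳ-≤ 0≤l (≤-trans R≤4 4≤C)) ⟩
        ϵ * (C * l)               ≈⟨ solve 3 (λ c ϵ l → ϵ :* (c :* l) := c :* ϵ :* l) refl C ϵ l ⟩
        C * ϵ * l                 ≤⟨ x≤x+y _ 0≤C ⟩
        C * ϵ * l + C             ∎

      bound-small : R ≤ fromℕ 4 → ∀ h → form Aᶠ h h ≤ t * degreeNorm h
      bound-small R≤4 h = begin
        form Aᶠ h h        ≤⟨ form-A≤degreeNorm h ⟩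
        degreeNorm h       ≈⟨ *-identityˡ _ ⟨
        1# * degreeNorm h  ≤⟨ *-monoʳ-≤ (degreeNorm-nonneg h) (≤/ (fromℕ-pos δ)
                                (≤-trans (≤-reflexive (*-identityˡ _)) (δ≤Cϵl+C R≤4))) ⟩
        t * degreeNorm h   ∎

      δ*normSq≤degreeNorm : ∀ h → fromℕ δ * normSq h ≤ degreeNorm h
      δ*normSq≤degreeNorm h = begin
        fromℕ δ * normSq h                  ≈⟨ *-distribˡ-sum (fromℕ δ) (λ u → h u * h u) ⟩
        ∑ (λ u → fromℕ δ * (h u * h u))     ≤⟨ ∑-mono-≤ (λ u → *-monoʳ-≤ (x*x-nonneg (h u)) (fromℕ-mono-≤ (δ≤degree u))) ⟩
        degreeNorm h                        ∎

      -- From k ≤ 2 + 2l one gets 2k + 2 ≤ 6 + 4l ≤ 10l, the 6 being absorbed by 1 ≤ l. The factor 8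
      -- is the 4 of `form≤` doubled by the two blocks, whence 80.
      constant≤ : ∀ k → 1# ≤ l → fromℕ k ≤ fromℕ 2 + fromℕ 2 * l →
        fromℕ 8 * (ϵ * fromℕ (2 ℕ.* k ℕ.+ 2)) ≤ C * ϵ * l + C
      constant≤ k 1≤l k≤ = begin
        fromℕ 8 * (ϵ * fromℕ (2 ℕ.* k ℕ.+ 2))
          ≤⟨ *-monoˡ-≤ (fromℕ-nonneg 8) (*-monoˡ-≤ 0≤ϵ (begin
            fromℕ (2 ℕ.* k ℕ.+ 2)                          ≈⟨ trans (fromℕ-+ (2 ℕ.* k) 2) (+-congʳ (fromℕ-* 2 k)) ⟩
            fromℕ 2 * fromℕ k + fromℕ 2                    ≤⟨ +-monoˡ-≤ (fromℕ 2) (*-monoˡ-≤ (fromℕ-nonneg 2) k≤) ⟩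
            fromℕ 2 * (fromℕ 2 + fromℕ 2 * l) + fromℕ 2    ≈⟨ solve 1 (λ l → two :* (two :+ two :* l) :+ two := con (+ 6) :* con (+ 1) :+ con (+ 4) :* l) refl l ⟩
            6# * 1# + 4# * l                               ≤⟨ +-monoˡ-≤ (4# * l) (*-monoˡ-≤ 0≤6 1≤l) ⟩
            6# * l + 4# * l                                ≈⟨ solve 1 (λ l → con (+ 6) :* l :+ con (+ 4) :* l := ten :* l) refl l ⟩
            fromℕ 10 * l                                   ∎)) ⟩
        fromℕ 8 * (ϵ * (fromℕ 10 * l))
          ≈⟨ solve 4 (λ a b ϵ l → a :* (ϵ :* (b :* l)) := a :* b :* ϵ :* l) refl (fromℕ 8) (fromℕ 10) ϵ l ⟩
        fromℕ 8 * fromℕ 10 * ϵ * l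
          ≤⟨ *-monoʳ-≤ 0≤l (*-monoʳ-≤ 0≤ϵ 80≤C) ⟩
        C * ϵ * l
          ≤⟨ x≤x+y _ 0≤C ⟩
        C * ϵ * l + C ∎
        where
        4# 6# : Carrier
        4# = 1# + 1# + 1# + 1#
        6# = 4# + 1# + 1#
        0≤6 : 0# ≤ 6#
        0≤6 = ≤-trans (fromℕ-nonneg 6) (≤-reflexive
          (solve 0 (con (+ 1) :+ (con (+ 1) :+ (con (+ 1) :+ (con (+ 1) :+ (con (+ 1) :+ (con (+ 1) :+ con (+ 0)))))) := con (+ 6)) refl))
        two ten : ∀ {m} → _
        two {m} = con {m} (+ 1) :+ (con (+ 1) :+ con (+ 0))
        ten {m} = con {m} (+ 1) :+ (con (+ 1) :+ (con (+ 1) :+ (con (+ 1) :+ (con (+ 1) :+ (con (+ 1) :+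
                  (con (+ 1) :+ (con (+ 1) :+ (con (+ 1) :+ (con (+ 1) :+ con (+ 0))))))))))

      bound-large : fromℕ 4 ≤ R → ∀ h → ∑ (λ v → yᶠ v * h v) ≈ 0# → form Aᶠ h h ≤ t * degreeNorm h
      bound-large 4≤R h ∑yh≈0 = begin
        form Aᶠ h h
          ≈⟨ form-A≈2*form-E h ∑yh≈0 ⟩
        form E h h + form E h h
          ≤⟨ +-mono-≤ form-E≤ form-E≤ ⟩
        fromℕ 4 * κ * normSq h + fromℕ 4 * κ * normSq h
          ≈⟨ solve 3 (λ c k n → c :* k :* n :+ c :* k :* n := (c :+ c) :* k :* n) refl (fromℕ 4) κ (normSq h) ⟩
        (fromℕ 4 + fromℕ 4) * κ * normSq h
          ≈⟨ *-congʳ (*-congʳ (fromℕ-+ 4 4)) ⟨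
        fromℕ 8 * κ * normSq h
          ≤⟨ *-monoʳ-≤ (normSq-nonneg h) (constant≤ k (1≤log _ 4≤R) (proj₂ (proj₂ digits))) ⟩
        (C * ϵ * l + C) * normSq h
          ≈⟨ *-congʳ t*δ≈ ⟨
        t * fromℕ δ * normSq h
          ≈⟨ *-assoc _ _ _ ⟩
        t * (fromℕ δ * normSq h)
          ≤⟨ *-monoˡ-≤ 0≤t (δ*normSq≤degreeNorm h) ⟩
        t * degreeNorm h ∎
        where
        digits : ∃[ k ] (R ≤ fromℕ (2 ℕ.^ k) × fromℕ k ≤ fromℕ 2 + fromℕ 2 * l)
        digits = binary-length _ 1≤R
        k : ℕ
        k = proj₁ digits
        κ : Carrier
        κ = ϵ * fromℕ (2 ℕ.* k ℕ.+ 2)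
        K≤ : K ≤ ϵ * fromℕ (2 ℕ.^ k)
        K≤ = ≤-trans (≤-reflexive (sym ϵ*R≈K)) (*-monoˡ-≤ 0≤ϵ (proj₁ (proj₂ digits)))
        form-E≤ : form E h h ≤ fromℕ 4 * κ * normSq h
        form-E≤ = form≤ ϵ 0≤ϵ k E (E-discrepancy ϵ 0<ϵ disc k K≤) (-E-discrepancy ϵ 0<ϵ disc k K≤) h

    gapBound≤gap : ∀ λ₂ → IsSpectralGap λ₂ → gapBound C ϵ 0<ϵ ≤ λ₂
    gapBound≤gap λ₂ gap = ≤-trans (x-y≤x (1# - t) (/-nonneg
        (*-nonneg (*-nonneg (fromℕ-nonneg 2) (deviation-nonneg X)) (deviation-nonneg Y)) _))
      (≤-cases {R} {fromℕ 4}
        (λ R≤4 → 1-t≤gap t (λ h _ → bound-small R≤4 h) λ₂ gap)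
        (λ 4≤R → 1-t≤gap t (bound-large 4≤R) λ₂ gap))

theorem6p7 : ∀ {c ℓ₁ ℓ₂} (ℝ : RealNumbers c ℓ₁ ℓ₂) →
    let open RealNumbers ℝ
        open ConnectedBipartiteGraph using (Δ)
        open Invariants ℝ
    in
    ∃[ C ] (∀ (G : ConnectedBipartiteGraph) (ϵ : Carrier) (0<ϵ : 0# < ϵ) →
      ϵ ≤ fromℕ (Δ G) →
      Discrepancy≤ G ϵ →
      ∀ λ₂ → IsSpectralGap G λ₂ → gapBound G C ϵ 0<ϵ ≤ λ₂)
theorem6p7 ℝ = fromℕ 8 * fromℕ 10 , λ G → SpectralGap.gapBound≤gap ℝ G (fromℕ 8 * fromℕ 10) ≤-refl
  where
  open RealNumbers ℝ
  open OrderedFieldProperties ℝ
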